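{- Let $p>2$ be prime and let $k \geq 3$. Let $\Psi$ be a $2\times k$ system over $\mathbb{F}_p$ such that $s(\Psi)=k-1$. Then there exist an integer $n >0$ and a function $f: \mathbb{F}_p^n \to [-1,1]$ with $\mathbb{E}_{x\in\mathbb{F}_p^n} f(x) = 0$ such that $T_\Psi(f) < 0$.
   Context: A $2\times k$ system $\Psi$ is a system of $2$ homogeneous linear equations in $k$ variables, given by a $2\times k$ matrix $M_\Psi$ over $\mathbb{F}_p$ of full rank $2$. For $n\ge1$, $\mathrm{sol}(\Psi;\mathbb{F}_p^n)$ is the set of $x=(x_1,\dots,x_k)\in(\mathbb{F}_p^n)^k$ with $M_\Psi x=0$. For $f:\mathbb{F}_p^n\to\mathbb{C}$, $T_\Psi(f)=\mathbb{E}_{x\in \mathrm{sol}(\Psi;\mathbb{F}_p^n)} f(x_1)\cdots f(x_k)$ (normalised average). The length of an equation is its number of nonzero coefficients; $s(\Psi)$ is the minimum length of a nonzero equation in the row space of $M_\Psi$ (equivalently here, $s(\Psi)=k-1$ means every $2\times2$ minor of $M_\Psi$ is nonsingular). -}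

module Defs where

open import Data.Nat as ℕ using (ℕ; zero; suc; NonZero; _≡ᵇ_)
open import Data.Nat.DivMod using (_mod_)
open import Data.Fin using (Fin; toℕ)
open import Data.Fin.Base using () renaming (zero to f0; suc to fs)
open import Data.Integer using (+_)
open import Data.Rational as ℚ using (ℚ; 0ℚ; 1ℚ)
open import Data.List using (List; []; _∷_; map; concatMap; filterᵇ; length; allFin)
open import Data.Vec using (Vec; lookup) renaming ([] to []ᵥ; _∷_ to _∷ᵥ_)
open import Data.Bool using (Bool; true; false; not; _∧_)
open import Relation.Binary.PropositionalEquality using (_≡_; _≢_)
open import Data.Product using (Σ; _×_; ∃)

module _ {p : ℕ} .{{_ : NonZero p}} where

  infixl 6 _+F_
  infixl 7 _*F_

  _+F_ : Fin p → Fin p → Fin p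
  a +F b = (toℕ a ℕ.+ toℕ b) mod p

  _*F_ : Fin p → Fin p → Fin p
  a *F b = (toℕ a ℕ.* toℕ b) mod p

  0F : Fin p
  0F = 0 mod p

isZeroF : {p : ℕ} → Fin p → Bool
isZeroF a = toℕ a ≡ᵇ 0

sumF : {p : ℕ} .{{_ : NonZero p}} (k : ℕ) → (Fin k → Fin p) → Fin p
sumF zero    g = 0F
sumF (suc k) g = g f0 +F sumF k (λ j → g (fs j))

System : (p k : ℕ) → Set
System p k = Fin 2 → Fin k → Fin p

row₀ row₁ : Fin 2
row₀ = f0
row₁ = fs f0

rowComb : {p k : ℕ} .{{_ : NonZero p}} → System p k → Fin p → Fin p → Fin k → Fin p
rowComb M a b j = a *F M row₀ j +F b *F M row₁ j

NonzeroVec : {p k : ℕ} → (Fin k → Fin p) → Set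
NonzeroVec {p} {k} v = ∃ λ (j : Fin k) → toℕ (v j) ≢ 0

eqLength : {p k : ℕ} → (Fin k → Fin p) → ℕ
eqLength {p} {k} v = length (filterᵇ (λ j → not (isZeroF (v j))) (allFin k))

FullRank : {p k : ℕ} .{{_ : NonZero p}} → System p k → Set
FullRank {p} {k} M =
  (a b : Fin p) → ((j : Fin k) → toℕ (rowComb M a b j) ≡ 0) → (toℕ a ≡ 0) × (toℕ b ≡ 0)

sIs : {p k : ℕ} .{{_ : NonZero p}} → System p k → ℕ → Set
sIs {p} {k} M s =
  ((a b : Fin p) → NonzeroVec (rowComb M a b) → s ℕ.≤ eqLength (rowComb M a b))
  × (Σ (Fin p) λ a → Σ (Fin p) λ b →
       NonzeroVec (rowComb M a b) × (eqLength (rowComb M a b) ≡ s))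

allVecs : {A : Set} → List A → (n : ℕ) → List (Vec A n)
allVecs xs zero    = []ᵥ ∷ []
allVecs xs (suc n) = concatMap (λ x → map (x ∷ᵥ_) (allVecs xs n)) xs

allFpn : (p n : ℕ) → List (Vec (Fin p) n)
allFpn p n = allVecs (allFin p) n

sumℚ : List ℚ → ℚ
sumℚ []       = 0ℚ
sumℚ (x ∷ xs) = x ℚ.+ sumℚ xs

prodVecℚ : {m : ℕ} → Vec ℚ m → ℚ
prodVecℚ []ᵥ       = 1ℚ
prodVecℚ (x ∷ᵥ xs) = x ℚ.* prodVecℚ xs

mean : List ℚ → ℚ
mean xs with length xs
... | zero  = 0ℚ
... | suc m = sumℚ xs ℚ.* ((+ 1) ℚ./ suc m)

expect : {p n : ℕ} → (Vec (Fin p) n → ℚ) → ℚ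
expect {p} {n} f = mean (map f (allFpn p n))

isSol : {p k n : ℕ} .{{_ : NonZero p}} → System p k → Vec (Vec (Fin p) n) k → Bool
isSol {p} {k} {n} M x = allB (allFin 2) λ i → allB (allFin n) λ t →
    isZeroF (sumF k (λ j → M i j *F lookup (lookup x j) t))
  where
  allB : {A : Set} → List A → (A → Bool) → Bool
  allB []       P = true
  allB (y ∷ ys) P = P y ∧ allB ys P

sol : {p k : ℕ} .{{_ : NonZero p}} → System p k → (n : ℕ) → List (Vec (Vec (Fin p) n) k)
sol {p} {k} M n = filterᵇ (isSol M) (allVecs (allFpn p n) k)

TΨ : {p k n : ℕ} .{{_ : NonZero p}} → System p k → (Vec (Fin p) n → ℚ) → ℚ
TΨ {p} {k} {n} M f = mean (map (λ x → prodVecℚ (Data.Vec.map f x)) (sol M n))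

{-# OPTIONS --safe #-}
module Submission where

-- Sums over sol(Ψ; F_p^n) factor over coordinates, and only functions of [u = 0] are needed on each coordinate.
-- Put a = p and h₀(u) = a[u = 0] − 1.  Since any two columns of M are independent, the average over sol(Ψ; F_p) of
-- ∏_j (A_j + h₀(u_j)) is ∏ A_j + (a − 1) Σ A_j + (a − 1)(a + 1 − k), and Σ_j A_j is preserved on average.  Hence with
-- h(x) = Σ_t h₀(x_t) on F_p^n the average of ∏_j (A_j + h(x_j)) is ∏ A_j + n((a − 1) Σ A_j + (a − 1)(a + 1 − k)).
-- For A_j = −a this equals (−a)^k − n(a² − 1)(k − 1), which is negative for n = p^k.  The function h − a has nonzero
-- mean, so it is multiplied by the mean-zero function a²[u = 0][u′ = 0] − 1 of two further coordinates; this
-- multiplies the average by (a² − 1)(a² + 1 − k), and k ≤ p² because the columns of M are distinct.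

open import Defs
open import Data.Nat as ℕ using (ℕ; zero; suc; NonZero; _<_; _≤_; _∸_; z≤n; s≤s)
import Data.Nat.Properties as ℕ
import Data.Nat.Divisibility as ℕ
import Data.Nat.DivMod as ℕ
open import Data.Nat.Primality using (Prime)
open import Data.Nat.Coprimality using (prime⇒coprime; coprime-Bézout)
open import Data.Nat.GCD using (module Bézout)
open import Data.Fin using (Fin; zero; suc; toℕ; fromℕ<; combine)
open import Data.Fin.Properties using (suc-injective; toℕ-fromℕ<; toℕ<n; toℕ-injective; any?; combine-injective; injective⇒≤) renaming (_≟_ to _≟ᶠ_)
import Data.Integer as ℤ
open ℤ using (ℤ; 0ℤ; 1ℤ)
import Data.Integer.Properties as ℤ
import Data.Integer.DivMod as ℤ
open import Data.Integer.Divisibility.Signed using (_∣_; divides; _∣?_; ∣⇒∣ᵤ)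
open import Data.Integer.Tactic.RingSolver using (solve-∀)
open import Data.Rational as ℚ using (ℚ; 0ℚ; 1ℚ; -_; _+_; _*_; _-_; _/_; 1/_; Positive; positive; nonNegative) renaming (_≤_ to _≤ℚ_; _<_ to _<ℚ_)
open import Data.Rational.Properties
open import Data.Rational.Solver using (module +-*-Solver)
open import Data.Vec as Vec using (Vec; []; _∷_; lookup; zipWith)
open import Data.Vec.Properties using (lookup-zipWith)
open import Data.List using (List; []; _∷_; _++_; map; concatMap; filterᵇ; length; allFin; tabulate)
open import Data.Bool using (Bool; true; false; not; _∧_)
open import Data.Product using (Σ; _×_; _,_; ∃; ∃₂; proj₁; proj₂)
open import Data.Sum using (_⊎_; inj₁; inj₂)
open import Function using (_∘_; id)
open import Relation.Nullary using (¬_; ¬?; Dec; yes; no; does; contradiction)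
open import Relation.Nullary.Decidable using (dec-true; dec-false; decidable-stable)
open import Relation.Binary.PropositionalEquality using (_≡_; _≢_; refl; sym; trans; cong; cong₂; subst; module ≡-Reasoning)
open +-*-Solver using (solve; _:=_; _:+_; _:*_; _:-_; :-_; con)

-- Finite sums and products

-- The mean-zero function `h` alone does not suffice: with all A_j = 0 its average is n(a - 1)(a + 1
-- - k). Pairwise independent columns represent distinct points of the projective line, so k ≤ p + 1
-- and this is never negative. A negative shift makes the coefficient of n negative; -a is
-- convenient because -ak + a + 1 - k = (a + 1)(1 - k). The sign of (-a)^k depends on the parity of
-- k, but this term does not grow with n. The factor that restores mean zero must not spoil the
-- sign. One further coordinate with the factor `h₀` would multiply the average by (a - 1)(a + 1 -
-- k), which vanishes for k = p + 1. On two coordinates the indicator of the origin has density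
-- 1/a², and a + 1 - k is replaced by the positive a² + 1 - k. Indicators of zero are enough because
-- the number of solutions over F_p in which given variables vanish depends only on how many
-- variables stay free. The averages are therefore the same for all systems with the same p and k.

∑ : {A : Set} → List A → (A → ℚ) → ℚ
∑ xs f = sumℚ (map f xs)

∏ : (m : ℕ) → (Fin m → ℚ) → ℚ
∏ zero    f = 1ℚ
∏ (suc m) f = f zero * ∏ m (f ∘ suc)

𝟙 : Bool → ℚ
𝟙 true  = 1ℚ
𝟙 false = 0ℚ

ι : ℕ → ℚ
ι zero    = 0ℚ
ι (suc n) = 1ℚ + ι n

module _ {A : Set} where

  open ≡-Reasoning

  ∑-cong : (xs : List A) {f g : A → ℚ} → (∀ x → f x ≡ g x) → ∑ xs f ≡ ∑ xs g
  ∑-cong []       e = refl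
  ∑-cong (x ∷ xs) e = cong₂ _+_ (e x) (∑-cong xs e)

  ∑-zero : (xs : List A) → ∑ xs (λ _ → 0ℚ) ≡ 0ℚ
  ∑-zero []       = refl
  ∑-zero (x ∷ xs) = trans (+-identityˡ _) (∑-zero xs)

  ∑-+ : (xs : List A) (f g : A → ℚ) → ∑ xs (λ x → f x + g x) ≡ ∑ xs f + ∑ xs g
  ∑-+ []       f g = refl
  ∑-+ (x ∷ xs) f g = trans (cong ((f x + g x) +_) (∑-+ xs f g))
    (solve 4 (λ a b c d → (a :+ b) :+ (c :+ d) := (a :+ c) :+ (b :+ d)) refl (f x) (g x) (∑ xs f) (∑ xs g))

  ∑-*ˡ : (xs : List A) (a : ℚ) (f : A → ℚ) → ∑ xs (λ x → a * f x) ≡ a * ∑ xs f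
  ∑-*ˡ []       a f = sym (*-zeroʳ a)
  ∑-*ˡ (x ∷ xs) a f = trans (cong (a * f x +_) (∑-*ˡ xs a f)) (sym (*-distribˡ-+ a (f x) (∑ xs f)))

  ∑-*ʳ : (xs : List A) (f : A → ℚ) (a : ℚ) → ∑ xs (λ x → f x * a) ≡ ∑ xs f * a
  ∑-*ʳ xs f a = begin
    ∑ xs (λ x → f x * a) ≡⟨ ∑-cong xs (λ x → *-comm (f x) a) ⟩
    ∑ xs (λ x → a * f x) ≡⟨ ∑-*ˡ xs a f ⟩
    a * ∑ xs f           ≡⟨ *-comm a (∑ xs f) ⟩
    ∑ xs f * a           ∎

  ∑-++ : (xs ys : List A) (f : A → ℚ) → ∑ (xs ++ ys) f ≡ ∑ xs f + ∑ ys f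
  ∑-++ []       ys f = sym (+-identityˡ (∑ ys f))
  ∑-++ (x ∷ xs) ys f = trans (cong (f x +_) (∑-++ xs ys f)) (sym (+-assoc (f x) (∑ xs f) (∑ ys f)))

  ∑-filter : (P : A → Bool) (xs : List A) (f : A → ℚ) → ∑ (filterᵇ P xs) f ≡ ∑ xs (λ x → 𝟙 (P x) * f x)
  ∑-filter P []       f = refl
  ∑-filter P (x ∷ xs) f with P x
  ... | true  = cong₂ _+_ (sym (*-identityˡ (f x))) (∑-filter P xs f)
  ... | false = begin
    ∑ (filterᵇ P xs) f                        ≡⟨ ∑-filter P xs f ⟩
    ∑ xs (λ y → 𝟙 (P y) * f y)                ≡⟨ +-identityˡ _ ⟨
    0ℚ + ∑ xs (λ y → 𝟙 (P y) * f y)           ≡⟨ cong (_+ ∑ xs (λ y → 𝟙 (P y) * f y)) (*-zeroˡ (f x)) ⟨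
    0ℚ * f x + ∑ xs (λ y → 𝟙 (P y) * f y)     ∎

∑-map : {A B : Set} (h : A → B) (xs : List A) (f : B → ℚ) → ∑ (map h xs) f ≡ ∑ xs (f ∘ h)
∑-map h []       f = refl
∑-map h (x ∷ xs) f = cong (f (h x) +_) (∑-map h xs f)

∑-concatMap : {A B : Set} (h : A → List B) (xs : List A) (f : B → ℚ) →
  ∑ (concatMap h xs) f ≡ ∑ xs (λ x → ∑ (h x) f)
∑-concatMap h []       f = refl
∑-concatMap h (x ∷ xs) f = trans (∑-++ (h x) (concatMap h xs) f) (cong (∑ (h x) f +_) (∑-concatMap h xs f))

∑-swap : {A B : Set} (xs : List A) (ys : List B) (f : A → B → ℚ) →
  ∑ xs (λ x → ∑ ys (f x)) ≡ ∑ ys (λ y → ∑ xs (λ x → f x y))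
∑-swap []       ys f = sym (∑-zero ys)
∑-swap (x ∷ xs) ys f = trans (cong (∑ ys (f x) +_) (∑-swap xs ys f))
  (sym (∑-+ ys (f x) (λ y → ∑ xs (λ z → f z y))))

∑-tabulate-zero : {A : Set} (n : ℕ) (g : Fin n → A) (f : A → ℚ) →
  (∀ j → f (g j) ≡ 0ℚ) → ∑ (tabulate g) f ≡ 0ℚ
∑-tabulate-zero zero    g f e = refl
∑-tabulate-zero (suc n) g f e = cong₂ _+_ (e zero) (∑-tabulate-zero n (g ∘ suc) f (e ∘ suc))

∑-tabulate-single : {A : Set} (n : ℕ) (g : Fin n → A) (f : A → ℚ) (i : Fin n) →
  (∀ j → j ≢ i → f (g j) ≡ 0ℚ) → ∑ (tabulate g) f ≡ f (g i)
∑-tabulate-single (suc n) g f zero e =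
  trans (cong (f (g zero) +_) (∑-tabulate-zero n (g ∘ suc) f (λ j → e (suc j) (λ ())))) (+-identityʳ _)
∑-tabulate-single (suc n) g f (suc i) e =
  trans (cong₂ _+_ (e zero (λ ())) (∑-tabulate-single n (g ∘ suc) f i (λ j j≢i → e (suc j) (j≢i ∘ suc-injective))))
    (+-identityˡ _)

∑-allFin-single : (n : ℕ) (f : Fin n → ℚ) (i : Fin n) →
  (∀ j → j ≢ i → f j ≡ 0ℚ) → ∑ (allFin n) f ≡ f i
∑-allFin-single n f i e = ∑-tabulate-single n id f i e

∑-tabulate-const : {A : Set} (n : ℕ) (g : Fin n → A) (a : ℚ) → ∑ (tabulate g) (λ _ → a) ≡ ι n * a
∑-tabulate-const zero    g a = sym (*-zeroˡ a)
∑-tabulate-const (suc n) g a = begin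
  a + ∑ (tabulate (g ∘ suc)) (λ _ → a) ≡⟨ cong (a +_) (∑-tabulate-const n (g ∘ suc) a) ⟩
  a + ι n * a                          ≡⟨ solve 2 (λ a n → a :+ n :* a := (con 1ℚ :+ n) :* a) refl a (ι n) ⟩
  (1ℚ + ι n) * a                       ∎
  where
  open ≡-Reasoning

∑-allFin-const : (n : ℕ) (a : ℚ) → ∑ (allFin n) (λ _ → a) ≡ ι n * a
∑-allFin-const n a = ∑-tabulate-const n id a

∑-allVecs-suc : {A : Set} (xs : List A) (n : ℕ) (f : Vec A (suc n) → ℚ) →
  ∑ (allVecs xs (suc n)) f ≡ ∑ xs (λ x → ∑ (allVecs xs n) (λ v → f (x ∷ v)))
∑-allVecs-suc xs n f = trans (∑-concatMap _ xs f) (∑-cong xs (λ x → ∑-map (x ∷_) (allVecs xs n) f))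

-- This is the splitting over coordinates: k points of length `suc n` are k first entries zipped
-- onto k points of length n. The two sides enumerate the tuples in different orders, hence the
-- exchange of sums in the induction.
∑-allVecs-zipWith-∷ : {A : Set} (xs : List A) (n k : ℕ) (f : Vec (Vec A (suc n)) k → ℚ) →
  ∑ (allVecs (allVecs xs (suc n)) k) f ≡
  ∑ (allVecs xs k) (λ u → ∑ (allVecs (allVecs xs n) k) (λ y → f (zipWith _∷_ u y)))
∑-allVecs-zipWith-∷ xs n zero    f = sym (+-identityʳ _)
∑-allVecs-zipWith-∷ xs n (suc k) f = begin
  ∑ (allVecs (allVecs xs (suc n)) (suc k)) f
    ≡⟨ ∑-allVecs-suc (allVecs xs (suc n)) k f ⟩
  ∑ (allVecs xs (suc n)) (λ x → ∑ (allVecs (allVecs xs (suc n)) k) (λ X → f (x ∷ X)))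
    ≡⟨ ∑-allVecs-suc xs n _ ⟩
  ∑ xs (λ h → ∑ Y (λ t → ∑ (allVecs (allVecs xs (suc n)) k) (λ X → f ((h ∷ t) ∷ X))))
    ≡⟨ ∑-cong xs (λ h → ∑-cong Y (λ t → ∑-allVecs-zipWith-∷ xs n k (λ X → f ((h ∷ t) ∷ X)))) ⟩
  ∑ xs (λ h → ∑ Y (λ t → ∑ (allVecs xs k) (λ u → ∑ (allVecs Y k) (λ y → f ((h ∷ t) ∷ zipWith _∷_ u y)))))
    ≡⟨ ∑-cong xs (λ h → ∑-swap Y (allVecs xs k) _) ⟩
  ∑ xs (λ h → ∑ (allVecs xs k) (λ u → ∑ Y (λ t → ∑ (allVecs Y k) (λ y → f ((h ∷ t) ∷ zipWith _∷_ u y)))))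
    ≡⟨ ∑-cong xs (λ h → ∑-cong (allVecs xs k) (λ u → ∑-allVecs-suc Y k (λ z → f (zipWith _∷_ (h ∷ u) z)))) ⟨
  ∑ xs (λ h → ∑ (allVecs xs k) (λ u → ∑ (allVecs Y (suc k)) (λ z → f (zipWith _∷_ (h ∷ u) z))))
    ≡⟨ ∑-allVecs-suc xs k _ ⟨
  ∑ (allVecs xs (suc k)) (λ u → ∑ (allVecs Y (suc k)) (λ z → f (zipWith _∷_ u z)))
    ∎
  where
  open ≡-Reasoning
  Y = allVecs xs n

∏-cong : ∀ m {f g : Fin m → ℚ} → (∀ j → f j ≡ g j) → ∏ m f ≡ ∏ m g
∏-cong zero    e = refl
∏-cong (suc m) e = cong₂ _*_ (e zero) (∏-cong m (e ∘ suc))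

∏-* : ∀ m (f g : Fin m → ℚ) → ∏ m (λ j → f j * g j) ≡ ∏ m f * ∏ m g
∏-* zero    f g = refl
∏-* (suc m) f g = trans (cong ((f zero * g zero) *_) (∏-* m (f ∘ suc) (g ∘ suc)))
  (solve 4 (λ a b c d → (a :* b) :* (c :* d) := (a :* c) :* (b :* d)) refl
    (f zero) (g zero) (∏ m (f ∘ suc)) (∏ m (g ∘ suc)))

-- Passing from the mean to the sum means that the number of solutions over F_p^n never has to be
-- computed.
mean-negative : ∀ xs → sumℚ xs <ℚ 0ℚ → mean xs <ℚ 0ℚ
mean-negative []       s<0 = s<0
mean-negative (x ∷ xs) s<0 = begin-strict
  sumℚ (x ∷ xs) * c <⟨ *-monoˡ-<-pos c {{normalize-pos 1 (suc (length xs))}} s<0 ⟩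
  0ℚ * c            ≡⟨ *-zeroˡ c ⟩
  0ℚ                ∎
  where
  open ≤-Reasoning
  c = (ℤ.+ 1) / suc (length xs)

mean-zero : ∀ xs → sumℚ xs ≡ 0ℚ → mean xs ≡ 0ℚ
mean-zero []       s≡0 = refl
mean-zero (x ∷ xs) s≡0 = trans (cong (_* c) s≡0) (*-zeroˡ c)
  where c = (ℤ.+ 1) / suc (length xs)

-- Arithmetic modulo p

∣-lin₁ : ∀ {d x} z s → d ∣ x → z ≡ s ℤ.* x → d ∣ z
∣-lin₁ {d} z s (divides q refl) refl = divides (s ℤ.* q) (eq s q d)
  where
  eq : ∀ s q d → s ℤ.* (q ℤ.* d) ≡ s ℤ.* q ℤ.* d
  eq = solve-∀

-- Congruences are proved by naming multipliers of known multiples of d; what remains is a ring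
-- identity for the solver.
∣-lin₂ : ∀ {d x y} z s t → d ∣ x → d ∣ y → z ≡ s ℤ.* x ℤ.+ t ℤ.* y → d ∣ z
∣-lin₂ {d} z s t (divides q refl) (divides r refl) refl = divides (s ℤ.* q ℤ.+ t ℤ.* r) (eq s t q r d)
  where
  eq : ∀ s t q r d → s ℤ.* (q ℤ.* d) ℤ.+ t ℤ.* (r ℤ.* d) ≡ (s ℤ.* q ℤ.+ t ℤ.* r) ℤ.* d
  eq = solve-∀

-- The linear form is left unreduced in ℤ; reduction modulo p happens only in `δ`.
dot : ∀ {p} m → (Fin m → ℤ) → Vec (Fin p) m → ℤ
dot zero    c us       = 0ℤ
dot (suc m) c (u ∷ us) = c zero ℤ.* ℤ.+ toℕ u ℤ.+ dot m (c ∘ suc) us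

ε : ∀ {p} → Fin p → ℚ
ε u = 𝟙 (isZeroF u)

δ : ℕ → ℤ → ℚ
δ p z = 𝟙 (does (ℤ.+ p ∣? z))

δ-∣ : ∀ {p z} → ℤ.+ p ∣ z → δ p z ≡ 1ℚ
δ-∣ {p} {z} p∣z = cong 𝟙 (dec-true (ℤ.+ p ∣? z) p∣z)

δ-∤ : ∀ {p z} → ¬ (ℤ.+ p ∣ z) → δ p z ≡ 0ℚ
δ-∤ {p} {z} p∤z = cong 𝟙 (dec-false (ℤ.+ p ∣? z) p∤z)

δδ-∤ : ∀ {p y z} → ¬ (ℤ.+ p ∣ y × ℤ.+ p ∣ z) → δ p y * δ p z ≡ 0ℚ
δδ-∤ {p} {y} {z} n = by-cases (ℤ.+ p ∣? y)
  where
  by-cases : Dec (ℤ.+ p ∣ y) → δ p y * δ p z ≡ 0ℚ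
  by-cases (yes p∣y) = trans (cong (δ p y *_) (δ-∤ (λ p∣z → n (p∣y , p∣z)))) (*-zeroʳ (δ p y))
  by-cases (no  p∤y) = trans (cong (_* δ p z) (δ-∤ p∤y)) (*-zeroˡ (δ p z))

module _ {p : ℕ} .{{_ : NonZero p}} where

  residue : ℤ → Fin p
  residue z = fromℕ< (ℤ.n%ℕd<d z p)

  ∣-residue : ∀ z → ℤ.+ p ∣ z ℤ.- ℤ.+ toℕ (residue z)
  ∣-residue z = divides (z ℤ./ℕ p)
    (trans (cong₂ ℤ._-_ (ℤ.a≡a%ℕn+[a/ℕn]*n z p) (cong ℤ.+_ (toℕ-fromℕ< (ℤ.n%ℕd<d z p)))) (eq (ℤ.+ (z ℤ.%ℕ p)) _))
    where
    eq : ∀ r q → r ℤ.+ q ℤ.- r ≡ q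
    eq = solve-∀

  ∣-mod : ∀ n → ℤ.+ p ∣ ℤ.+ n ℤ.- ℤ.+ toℕ (n ℕ.mod p)
  ∣-mod n = ∣-residue (ℤ.+ n)

  ∣toℕ⇒≡0 : ∀ (u : Fin p) → ℤ.+ p ∣ ℤ.+ toℕ u → toℕ u ≡ 0
  ∣toℕ⇒≡0 u p∣u with toℕ u | toℕ<n u | ∣⇒∣ᵤ p∣u
  ... | zero  | _   | _  = refl
  ... | suc n | n<p | d∣ = contradiction n<p (ℕ.≤⇒≯ (ℕ.∣⇒≤ d∣))

  toℕ-0F : toℕ (0F {p}) ≡ 0
  toℕ-0F = ∣toℕ⇒≡0 0F (∣-lin₁ _ ℤ.-1ℤ (∣-mod 0) (eq (ℤ.+ toℕ (0F {p}))))
    where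
    eq : ∀ z → z ≡ ℤ.-1ℤ ℤ.* (0ℤ ℤ.- z)
    eq = solve-∀

  ∣-difference-≤ : ∀ (u v : Fin p) → toℕ v ℕ.≤ toℕ u → ℤ.+ p ∣ ℤ.+ toℕ u ℤ.- ℤ.+ toℕ v → u ≡ v
  ∣-difference-≤ u v v≤u p∣ = toℕ-injective (ℕ.≤-antisym (ℕ.m∸n≡0⇒m≤n u∸v≡0) v≤u)
    where
    u∸v<p : toℕ u ℕ.∸ toℕ v ℕ.< p
    u∸v<p = ℕ.≤-<-trans (ℕ.m∸n≤m (toℕ u) (toℕ v)) (toℕ<n u)
    w : Fin p
    w = fromℕ< u∸v<p
    u∸v≡0 : toℕ u ℕ.∸ toℕ v ≡ 0
    u∸v≡0 = trans (sym (toℕ-fromℕ< u∸v<p)) (∣toℕ⇒≡0 w (subst (ℤ.+ p ∣_)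
      (trans (ℤ.m-n≡m⊖n (toℕ u) (toℕ v)) (trans (ℤ.⊖-≥ v≤u) (cong ℤ.+_ (sym (toℕ-fromℕ< u∸v<p))))) p∣))

  ∣-difference⇒≡ : ∀ (u v : Fin p) → ℤ.+ p ∣ ℤ.+ toℕ u ℤ.- ℤ.+ toℕ v → u ≡ v
  ∣-difference⇒≡ u v p∣ with ℕ.≤-total (toℕ v) (toℕ u)
  ... | inj₁ v≤u = ∣-difference-≤ u v v≤u p∣
  ... | inj₂ u≤v = sym (∣-difference-≤ v u u≤v (∣-lin₁ _ ℤ.-1ℤ p∣ (eq (ℤ.+ toℕ u) (ℤ.+ toℕ v))))
    where
    eq : ∀ x y → y ℤ.- x ≡ ℤ.-1ℤ ℤ.* (x ℤ.- y)
    eq = solve-∀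

  ε-≢0 : ∀ (u : Fin p) → toℕ u ≢ 0 → ε u ≡ 0ℚ
  ε-≢0 u u≢0 with toℕ u
  ... | zero  = contradiction refl u≢0
  ... | suc _ = refl

  ε-≡0 : ∀ (u : Fin p) → toℕ u ≡ 0 → ε u ≡ 1ℚ
  ε-≡0 u u≡0 with toℕ u
  ... | zero  = refl

  ∣-sumF-dot : ∀ m (c : Fin m → Fin p) (us : Vec (Fin p) m) →
    ℤ.+ p ∣ dot m (λ j → ℤ.+ toℕ (c j)) us ℤ.- ℤ.+ toℕ (sumF m (λ j → c j *F lookup us j))
  ∣-sumF-dot zero    c []       = ∣-mod 0
  ∣-sumF-dot (suc m) c (u ∷ us) =
    ∣-lin₂ _ 1ℤ 1ℤ (∣-mod (toℕ (c zero) ℕ.* toℕ u)) rest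
      (eq (ℤ.+ toℕ (c zero)) (ℤ.+ toℕ u) (dot m (λ j → ℤ.+ toℕ (c (suc j))) us) (ℤ.+ toℕ h) (ℤ.+ toℕ (h +F S)) (ℤ.pos-* (toℕ (c zero)) (toℕ u)))
    where
    S = sumF m (λ j → c (suc j) *F lookup us j)
    h = c zero *F u
    eq₂ : ∀ d s h t → d ℤ.+ h ℤ.- t ≡ 1ℤ ℤ.* (h ℤ.+ s ℤ.- t) ℤ.+ 1ℤ ℤ.* (d ℤ.- s)
    eq₂ = solve-∀
    rest : ℤ.+ p ∣ dot m (λ j → ℤ.+ toℕ (c (suc j))) us ℤ.+ ℤ.+ toℕ h ℤ.- ℤ.+ toℕ (h +F S)
    rest = ∣-lin₂ _ 1ℤ 1ℤ (∣-mod (toℕ h ℕ.+ toℕ S)) (∣-sumF-dot m (c ∘ suc) us)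
      (eq₂ (dot m (λ j → ℤ.+ toℕ (c (suc j))) us) (ℤ.+ toℕ S) (ℤ.+ toℕ h) (ℤ.+ toℕ (h +F S)))
    eq₁ : ∀ a u d h t → a ℤ.* u ℤ.+ d ℤ.- t ≡ 1ℤ ℤ.* (a ℤ.* u ℤ.- h) ℤ.+ 1ℤ ℤ.* (d ℤ.+ h ℤ.- t)
    eq₁ = solve-∀
    eq : ∀ a u d h t {n} → n ≡ a ℤ.* u → a ℤ.* u ℤ.+ d ℤ.- t ≡ 1ℤ ℤ.* (n ℤ.- h) ℤ.+ 1ℤ ℤ.* (d ℤ.+ h ℤ.- t)
    eq a u d h t refl = eq₁ a u d h t

  -- This is the bridge from the arithmetic of `Fin p`, in which the system is stated, to
  -- divisibility in ℤ, in which the counting is done.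
  ε-sumF : ∀ m (c : Fin m → Fin p) (us : Vec (Fin p) m) →
    ε (sumF m (λ j → c j *F lookup us j)) ≡ δ p (dot m (λ j → ℤ.+ toℕ (c j)) us)
  ε-sumF m c us = by-cases (ℤ.+ p ∣? d)
    where
    s = sumF m (λ j → c j *F lookup us j)
    d = dot m (λ j → ℤ.+ toℕ (c j)) us
    eq : ∀ d s → s ≡ 1ℤ ℤ.* d ℤ.+ ℤ.-1ℤ ℤ.* (d ℤ.- s)
    eq = solve-∀
    eq₀ : ∀ d → d ≡ 1ℤ ℤ.* (d ℤ.- 0ℤ)
    eq₀ = solve-∀
    by-cases : Dec (ℤ.+ p ∣ d) → ε s ≡ δ p d
    by-cases (yes p∣d) = trans
      (ε-≡0 s (∣toℕ⇒≡0 s (∣-lin₂ _ 1ℤ ℤ.-1ℤ p∣d (∣-sumF-dot m c us) (eq d (ℤ.+ toℕ s)))))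
      (sym (δ-∣ p∣d))
    by-cases (no  p∤d) = trans
      (ε-≢0 s λ s≡0 → p∤d (∣-lin₁ _ 1ℤ
        (subst (λ n → ℤ.+ p ∣ d ℤ.- ℤ.+ n) s≡0 (∣-sumF-dot m c us)) (eq₀ d)))
      (sym (δ-∤ p∤d))

  ∣-rowComb : ∀ {k} (M : System p k) a b j →
    ℤ.+ p ∣ ℤ.+ toℕ a ℤ.* ℤ.+ toℕ (M row₀ j) ℤ.+ ℤ.+ toℕ b ℤ.* ℤ.+ toℕ (M row₁ j) ℤ.- ℤ.+ toℕ (rowComb M a b j)
  ∣-rowComb M a b j = ∣-lin₂ _ 1ℤ 1ℤ
    (∣-mod (toℕ x ℕ.+ toℕ y))
    (∣-lin₂ _ 1ℤ 1ℤ (∣-mod (toℕ a ℕ.* toℕ (M row₀ j))) (∣-mod (toℕ b ℕ.* toℕ (M row₁ j))) refl)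
    (eq (ℤ.+ toℕ x) (ℤ.+ toℕ y) (ℤ.+ toℕ (rowComb M a b j)) (ℤ.pos-* (toℕ a) (toℕ (M row₀ j))) (ℤ.pos-* (toℕ b) (toℕ (M row₁ j))))
    where
    x = a *F M row₀ j
    y = b *F M row₁ j
    eq₁ : ∀ x y r s t → s ℤ.+ t ℤ.- r ≡
      1ℤ ℤ.* (x ℤ.+ y ℤ.- r) ℤ.+ 1ℤ ℤ.* (1ℤ ℤ.* (s ℤ.- x) ℤ.+ 1ℤ ℤ.* (t ℤ.- y))
    eq₁ = solve-∀
    eq : ∀ x y r {s t m n} → m ≡ s → n ≡ t → s ℤ.+ t ℤ.- r ≡
      1ℤ ℤ.* (x ℤ.+ y ℤ.- r) ℤ.+ 1ℤ ℤ.* (1ℤ ℤ.* (m ℤ.- x) ℤ.+ 1ℤ ℤ.* (n ℤ.- y))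
    eq x y r {s} {t} refl refl = eq₁ x y r s t

  inverse : Prime p → ∀ z → ¬ (ℤ.+ p ∣ z) → ∃ λ w → ℤ.+ p ∣ w ℤ.* z ℤ.- 1ℤ
  inverse pr z p∤z = from-Bézout (coprime-Bézout (prime⇒coprime pr {{ℕ.≢-nonZero r≢0}} (toℕ<n (residue z))))
    where
    r = toℕ (residue z)
    eq₀ : ∀ z → z ≡ 1ℤ ℤ.* (z ℤ.- 0ℤ)
    eq₀ = solve-∀
    r≢0 : r ≢ 0
    r≢0 r≡0 = p∤z (∣-lin₁ z 1ℤ (subst (λ n → ℤ.+ p ∣ z ℤ.- ℤ.+ n) r≡0 (∣-residue z)) (eq₀ z))
    toℤ : ∀ a b c d → 1 ℕ.+ a ℕ.* b ≡ c ℕ.* d → 1ℤ ℤ.+ ℤ.+ a ℤ.* ℤ.+ b ≡ ℤ.+ c ℤ.* ℤ.+ d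
    toℤ a b c d e = trans (cong (λ n → 1ℤ ℤ.+ n) (sym (ℤ.pos-* a b))) (trans (cong ℤ.+_ e) (ℤ.pos-* c d))
    eq₁ : ∀ x y p z r → (ℤ.- y) ℤ.* z ℤ.- 1ℤ ≡ (ℤ.- y) ℤ.* (z ℤ.- r) ℤ.+ ℤ.-1ℤ ℤ.* (1ℤ ℤ.+ y ℤ.* r)
    eq₁ = solve-∀
    eq₂ : ∀ y z r → y ℤ.* z ℤ.- 1ℤ ≡ y ℤ.* (z ℤ.- r) ℤ.+ 1ℤ ℤ.* (y ℤ.* r ℤ.- 1ℤ)
    eq₂ = solve-∀
    eq₃ : ∀ s → (1ℤ ℤ.+ s) ℤ.- 1ℤ ≡ s
    eq₃ = solve-∀
    from-Bézout : Bézout.Identity 1 p r → ∃ λ w → ℤ.+ p ∣ w ℤ.* z ℤ.- 1ℤ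
    from-Bézout (Bézout.+- x y e) = ℤ.- ℤ.+ y ,
      ∣-lin₂ _ (ℤ.- ℤ.+ y) ℤ.-1ℤ (∣-residue z) (divides (ℤ.+ x) (toℤ y r x p e)) (eq₁ (ℤ.+ x) (ℤ.+ y) (ℤ.+ p) z (ℤ.+ r))
    from-Bézout (Bézout.-+ x y e) = ℤ.+ y ,
      ∣-lin₂ _ (ℤ.+ y) 1ℤ (∣-residue z)
        (divides (ℤ.+ x) (trans (cong (ℤ._- 1ℤ) (sym (toℤ x p y r e))) (eq₃ (ℤ.+ x ℤ.* ℤ.+ p))))
        (eq₂ (ℤ.+ y) z (ℤ.+ r))

  prime-cancelˡ : Prime p → ∀ {z} → ¬ (ℤ.+ p ∣ z) → ∀ {y} → ℤ.+ p ∣ z ℤ.* y → ℤ.+ p ∣ y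
  prime-cancelˡ pr {z} p∤z {y} p∣zy with inverse pr z p∤z
  ... | w , p∣wz-1 = ∣-lin₂ _ w (ℤ.- y) p∣zy p∣wz-1 (eq w z y)
    where
    eq : ∀ w z y → y ≡ w ℤ.* (z ℤ.* y) ℤ.+ (ℤ.- y) ℤ.* (w ℤ.* z ℤ.- 1ℤ)
    eq = solve-∀

∣-lin₃ : ∀ {d x y z} w r s t → d ∣ x → d ∣ y → d ∣ z → w ≡ r ℤ.* x ℤ.+ s ℤ.* y ℤ.+ t ℤ.* z → d ∣ w
∣-lin₃ {x = x} {y} {z} w r s t d∣x d∣y d∣z e = ∣-lin₂ w 1ℤ t (∣-lin₂ _ r s d∣x d∣y refl) d∣z
  (trans e (eq (r ℤ.* x ℤ.+ s ℤ.* y) (t ℤ.* z)))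
  where
  eq : ∀ a b → a ℤ.+ b ≡ 1ℤ ℤ.* a ℤ.+ b
  eq = solve-∀

det : ℤ → ℤ → ℤ → ℤ → ℤ
det c d c′ d′ = c ℤ.* d′ ℤ.- d ℤ.* c′

-- If (c, d) is nonzero modulo p, this is the indicator that (v, w) lies on the line through the
-- origin spanned by (c, d).
line : (p : ℕ) → ℤ → ℤ → ℤ → ℤ → ℚ
line p c d v w = ∑ (allFin p) (λ u → δ p (v ℤ.+ c ℤ.* ℤ.+ toℕ u) * δ p (w ℤ.+ d ℤ.* ℤ.+ toℕ u))

module _ {p : ℕ} .{{_ : NonZero p}} (pr : Prime p) where

  -- Two independent columns form a basis of F_p², so -(v, w) has exactly one pair of coordinates in
  -- it.
  ∑-line : ∀ c d c′ d′ → ¬ (ℤ.+ p ∣ det c d c′ d′) → ∀ v w →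
    ∑ (allFin p) (λ u → line p c′ d′ (v ℤ.+ c ℤ.* ℤ.+ toℕ u) (w ℤ.+ d ℤ.* ℤ.+ toℕ u)) ≡ 1ℚ
  ∑-line c d c′ d′ p∤Δ v w with inverse pr (det c d c′ d′) p∤Δ
  ... | e , p∣eΔ-1 = trans (∑-allFin-single p _ x off-x) (trans (∑-allFin-single p _ y off-y) at-xy)
    where
    -- Cramer's rule for c x + c′ y = -v and d x + d′ y = -w, with `e` an inverse of the determinant
    -- modulo p.
    X = e ℤ.* (c′ ℤ.* w ℤ.- d′ ℤ.* v)
    Y = e ℤ.* (d ℤ.* v ℤ.- c ℤ.* w)
    x = residue X
    y = residue Y
    F : ℤ → ℤ → ℤ → ℤ → ℤ → ℤ
    F v c c′ a b = v ℤ.+ c ℤ.* a ℤ.+ c′ ℤ.* b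
    eq-v : ∀ v w c d c′ d′ e x y → (v ℤ.+ c ℤ.* x ℤ.+ c′ ℤ.* y) ≡
      (ℤ.- v) ℤ.* (e ℤ.* (c ℤ.* d′ ℤ.- d ℤ.* c′) ℤ.- 1ℤ)
      ℤ.+ (ℤ.- c) ℤ.* (e ℤ.* (c′ ℤ.* w ℤ.- d′ ℤ.* v) ℤ.- x)
      ℤ.+ (ℤ.- c′) ℤ.* (e ℤ.* (d ℤ.* v ℤ.- c ℤ.* w) ℤ.- y)
    eq-v = solve-∀
    eq-w : ∀ v w c d c′ d′ e x y → (w ℤ.+ d ℤ.* x ℤ.+ d′ ℤ.* y) ≡
      (ℤ.- w) ℤ.* (e ℤ.* (c ℤ.* d′ ℤ.- d ℤ.* c′) ℤ.- 1ℤ)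
      ℤ.+ (ℤ.- d) ℤ.* (e ℤ.* (c′ ℤ.* w ℤ.- d′ ℤ.* v) ℤ.- x)
      ℤ.+ (ℤ.- d′) ℤ.* (e ℤ.* (d ℤ.* v ℤ.- c ℤ.* w) ℤ.- y)
    eq-w = solve-∀
    p∣v : ℤ.+ p ∣ F v c c′ (ℤ.+ toℕ x) (ℤ.+ toℕ y)
    p∣v = ∣-lin₃ _ (ℤ.- v) (ℤ.- c) (ℤ.- c′) p∣eΔ-1 (∣-residue X) (∣-residue Y) (eq-v v w c d c′ d′ e (ℤ.+ toℕ x) (ℤ.+ toℕ y))
    p∣w : ℤ.+ p ∣ F w d d′ (ℤ.+ toℕ x) (ℤ.+ toℕ y)
    p∣w = ∣-lin₃ _ (ℤ.- w) (ℤ.- d) (ℤ.- d′) p∣eΔ-1 (∣-residue X) (∣-residue Y) (eq-w v w c d c′ d′ e (ℤ.+ toℕ x) (ℤ.+ toℕ y))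
    at-xy = trans (cong₂ _*_ (δ-∣ p∣v) (δ-∣ p∣w)) (*-identityˡ 1ℚ)
    eq-x : ∀ v w c d c′ d′ x y a b → (c ℤ.* d′ ℤ.- d ℤ.* c′) ℤ.* (a ℤ.- x) ≡
      d′ ℤ.* (1ℤ ℤ.* (v ℤ.+ c ℤ.* a ℤ.+ c′ ℤ.* b) ℤ.+ ℤ.-1ℤ ℤ.* (v ℤ.+ c ℤ.* x ℤ.+ c′ ℤ.* y))
      ℤ.+ (ℤ.- c′) ℤ.* (1ℤ ℤ.* (w ℤ.+ d ℤ.* a ℤ.+ d′ ℤ.* b) ℤ.+ ℤ.-1ℤ ℤ.* (w ℤ.+ d ℤ.* x ℤ.+ d′ ℤ.* y))
    eq-x = solve-∀
    eq-y : ∀ v w c d c′ d′ x y a b → (c ℤ.* d′ ℤ.- d ℤ.* c′) ℤ.* (b ℤ.- y) ≡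
      (ℤ.- d) ℤ.* (1ℤ ℤ.* (v ℤ.+ c ℤ.* a ℤ.+ c′ ℤ.* b) ℤ.+ ℤ.-1ℤ ℤ.* (v ℤ.+ c ℤ.* x ℤ.+ c′ ℤ.* y))
      ℤ.+ c ℤ.* (1ℤ ℤ.* (w ℤ.+ d ℤ.* a ℤ.+ d′ ℤ.* b) ℤ.+ ℤ.-1ℤ ℤ.* (w ℤ.+ d ℤ.* x ℤ.+ d′ ℤ.* y))
    eq-y = solve-∀
    unique : ∀ a b → ℤ.+ p ∣ F v c c′ (ℤ.+ toℕ a) (ℤ.+ toℕ b) → ℤ.+ p ∣ F w d d′ (ℤ.+ toℕ a) (ℤ.+ toℕ b) →
      (a ≡ x) × (b ≡ y)
    unique a b p∣v′ p∣w′ =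
      ∣-difference⇒≡ a x (prime-cancelˡ pr p∤Δ (∣-lin₂ _ d′ (ℤ.- c′) dv dw
        (eq-x v w c d c′ d′ (ℤ.+ toℕ x) (ℤ.+ toℕ y) (ℤ.+ toℕ a) (ℤ.+ toℕ b)))) ,
      ∣-difference⇒≡ b y (prime-cancelˡ pr p∤Δ (∣-lin₂ _ (ℤ.- d) c dv dw
        (eq-y v w c d c′ d′ (ℤ.+ toℕ x) (ℤ.+ toℕ y) (ℤ.+ toℕ a) (ℤ.+ toℕ b))))
      where
      dv = ∣-lin₂ _ 1ℤ ℤ.-1ℤ p∣v′ p∣v refl
      dw = ∣-lin₂ _ 1ℤ ℤ.-1ℤ p∣w′ p∣w refl
    off-y : ∀ b → b ≢ y →
      δ p (F v c c′ (ℤ.+ toℕ x) (ℤ.+ toℕ b)) * δ p (F w d d′ (ℤ.+ toℕ x) (ℤ.+ toℕ b)) ≡ 0ℚ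
    off-y b b≢y = δδ-∤ (λ (p∣v′ , p∣w′) → b≢y (proj₂ (unique x b p∣v′ p∣w′)))
    off-x : ∀ a → a ≢ x → line p c′ d′ (v ℤ.+ c ℤ.* ℤ.+ toℕ a) (w ℤ.+ d ℤ.* ℤ.+ toℕ a) ≡ 0ℚ
    off-x a a≢x = trans (∑-cong (allFin p) (λ b → δδ-∤ (λ (p∣v′ , p∣w′) → a≢x (proj₁ (unique a b p∣v′ p∣w′)))))
      (∑-zero (allFin p))

  -- The second column only certifies that (c, d) is nonzero modulo p, which leaves u = 0 as the one
  -- solution.
  line-0 : ∀ c d c′ d′ → ¬ (ℤ.+ p ∣ det c d c′ d′) → line p c d 0ℤ 0ℤ ≡ 1ℚ
  line-0 c d c′ d′ p∤Δ = trans (∑-allFin-single p _ 0F off-0)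
    (trans (cong₂ _*_ (δ-∣ (at-0 c)) (δ-∣ (at-0 d))) (*-identityˡ 1ℚ))
    where
    eq₀ : ∀ c → 0ℤ ℤ.+ c ℤ.* 0ℤ ≡ 0ℤ
    eq₀ = solve-∀
    at-0 : ∀ c → ℤ.+ p ∣ 0ℤ ℤ.+ c ℤ.* ℤ.+ toℕ (0F {p})
    at-0 c = divides 0ℤ (trans (cong (λ n → 0ℤ ℤ.+ c ℤ.* ℤ.+ n) toℕ-0F) (eq₀ c))
    eq : ∀ c d c′ d′ u → (c ℤ.* d′ ℤ.- d ℤ.* c′) ℤ.* u ≡
      d′ ℤ.* (0ℤ ℤ.+ c ℤ.* u) ℤ.+ (ℤ.- c′) ℤ.* (0ℤ ℤ.+ d ℤ.* u)
    eq = solve-∀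
    unique : ∀ u → ℤ.+ p ∣ 0ℤ ℤ.+ c ℤ.* ℤ.+ toℕ u → ℤ.+ p ∣ 0ℤ ℤ.+ d ℤ.* ℤ.+ toℕ u → u ≡ 0F
    unique u p∣c p∣d = toℕ-injective (trans
      (∣toℕ⇒≡0 u (prime-cancelˡ pr p∤Δ (∣-lin₂ _ d′ (ℤ.- c′) p∣c p∣d (eq c d c′ d′ (ℤ.+ toℕ u)))))
      (sym toℕ-0F))
    off-0 : ∀ u → u ≢ 0F → δ p (0ℤ ℤ.+ c ℤ.* ℤ.+ toℕ u) * δ p (0ℤ ℤ.+ d ℤ.* ℤ.+ toℕ u) ≡ 0ℚ
    off-0 u u≢0 = δδ-∤ (λ (p∣c , p∣d) → u≢0 (unique u p∣c p∣d))

-- Affine weights on one coordinate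

PairwiseIndependent : (p : ℕ) {m : ℕ} (c d : Fin m → ℤ) → Set
PairwiseIndependent p c d = ∀ i j → i ≢ j → ¬ (ℤ.+ p ∣ det (c i) (d i) (c j) (d j))

module _ {p : ℕ} .{{_ : NonZero p}} where
  private
    a = ι p

  affineSum : ∀ m (c d : Fin m → ℤ) (P Q : Fin m → ℚ) → ℤ → ℤ → ℚ
  affineSum m c d P Q v w = ∑ (allVecs (allFin p) m) (λ us →
    δ p (v ℤ.+ dot m c us) * δ p (w ℤ.+ dot m d us) * ∏ m (λ j → P j + Q j * ε (lookup us j)))

  lineTerm : ∀ m (c d : Fin m → ℤ) (P Q : Fin m → ℚ) → ℤ → ℤ → ℚ
  lineTerm zero    c d P Q v w = 0ℚ
  lineTerm (suc m) c d P Q v w =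
    P zero * ∏ m (Q ∘ suc) * (a * a * line p (c zero) (d zero) v w - a)
    + Q zero * lineTerm m (c ∘ suc) (d ∘ suc) (P ∘ suc) (Q ∘ suc) v w

  -- Expand the product, and let S be the set of coordinates that contribute P_j; the others are
  -- forced to be zero. If |S| ≥ 2, two independent columns are free and there are p^(|S| - 2)
  -- solutions; multiplied by a² this is a^|S|, as in the first product. The other two summands
  -- correct the cases |S| = 0 and |S| = 1, where the first product has put 1 and a in place of a²
  -- times the true count.
  closedForm : ∀ m (c d : Fin m → ℤ) (P Q : Fin m → ℚ) → ℤ → ℤ → ℚ
  closedForm m c d P Q v w =
    ∏ m (λ j → a * P j + Q j) + ∏ m Q * (a * a * (δ p v * δ p w) - 1ℚ) + lineTerm m c d P Q v w

  affineSum-suc : ∀ m c d P Q v w → affineSum (suc m) c d P Q v w ≡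
    ∑ (allFin p) (λ u → (P zero + Q zero * ε u) *
      affineSum m (c ∘ suc) (d ∘ suc) (P ∘ suc) (Q ∘ suc) (v ℤ.+ c zero ℤ.* ℤ.+ toℕ u) (w ℤ.+ d zero ℤ.* ℤ.+ toℕ u))
  affineSum-suc m c d P Q v w = trans (∑-allVecs-suc (allFin p) m _) (∑-cong (allFin p) λ u →
    trans (∑-cong (allVecs (allFin p) m) (λ us → trans
      (cong₂ (λ x y → δ p x * δ p y * ((P zero + Q zero * ε u) * ∏ m (λ j → P (suc j) + Q (suc j) * ε (lookup us j))))
        (sym (ℤ.+-assoc v (c zero ℤ.* ℤ.+ toℕ u) (dot m (c ∘ suc) us)))
        (sym (ℤ.+-assoc w (d zero ℤ.* ℤ.+ toℕ u) (dot m (d ∘ suc) us))))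
      (eq (δ p (v ℤ.+ c zero ℤ.* ℤ.+ toℕ u ℤ.+ dot m (c ∘ suc) us) * δ p (w ℤ.+ d zero ℤ.* ℤ.+ toℕ u ℤ.+ dot m (d ∘ suc) us))
        (P zero + Q zero * ε u) (∏ m (λ j → P (suc j) + Q (suc j) * ε (lookup us j))))))
      (∑-*ˡ (allVecs (allFin p) m) (P zero + Q zero * ε u) _))
    where
    eq : ∀ x y z → x * (y * z) ≡ y * (x * z)
    eq = solve 3 (λ x y z → x :* (y :* z) := y :* (x :* z)) refl

  module _ (pr : Prime p) where

    -- A translate of the line spanned by (c₀, d₀) meets the line of each independent column in
    -- exactly one point, so every correction sums to a² - a · a = 0.
    ∑-lineTerm : ∀ m (c d : Fin m → ℤ) P Q c₀ d₀ → (∀ j → ¬ (ℤ.+ p ∣ det c₀ d₀ (c j) (d j))) → ∀ v w →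
      ∑ (allFin p) (λ u → lineTerm m c d P Q (v ℤ.+ c₀ ℤ.* ℤ.+ toℕ u) (w ℤ.+ d₀ ℤ.* ℤ.+ toℕ u)) ≡ 0ℚ
    ∑-lineTerm zero    c d P Q c₀ d₀ ind v w = ∑-zero (allFin p)
    ∑-lineTerm (suc m) c d P Q c₀ d₀ ind v w = begin
      ∑ F (λ u → x * (a * a * L u - a) + Q zero * T u)
        ≡⟨ ∑-+ F (λ u → x * (a * a * L u - a)) (λ u → Q zero * T u) ⟩
      ∑ F (λ u → x * (a * a * L u - a)) + ∑ F (λ u → Q zero * T u)
        ≡⟨ cong₂ _+_ (trans (∑-*ˡ F x (λ u → a * a * L u - a)) (cong (x *_) ∑L)) (∑-*ˡ F (Q zero) T) ⟩
      x * (a * a * 1ℚ + a * (- a)) + Q zero * ∑ F T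
        ≡⟨ cong (λ t → x * (a * a * 1ℚ + a * (- a)) + Q zero * t) (∑-lineTerm m (c ∘ suc) (d ∘ suc) (P ∘ suc) (Q ∘ suc) c₀ d₀ (ind ∘ suc) v w) ⟩
      x * (a * a * 1ℚ + a * (- a)) + Q zero * 0ℚ
        ≡⟨ solve 3 (λ x a q → x :* (a :* a :* con 1ℚ :+ a :* (:- a)) :+ q :* con 0ℚ := con 0ℚ) refl x a (Q zero) ⟩
      0ℚ ∎
      where
      open ≡-Reasoning
      F = allFin p
      x = P zero * ∏ m (Q ∘ suc)
      L T : Fin p → ℚ
      L u = line p (c zero) (d zero) (v ℤ.+ c₀ ℤ.* ℤ.+ toℕ u) (w ℤ.+ d₀ ℤ.* ℤ.+ toℕ u)
      T u = lineTerm m (c ∘ suc) (d ∘ suc) (P ∘ suc) (Q ∘ suc) (v ℤ.+ c₀ ℤ.* ℤ.+ toℕ u) (w ℤ.+ d₀ ℤ.* ℤ.+ toℕ u)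
      ∑L : ∑ F (λ u → a * a * L u - a) ≡ a * a * 1ℚ + a * (- a)
      ∑L = trans (∑-+ F (λ u → a * a * L u) (λ _ → - a)) (cong₂ _+_
        (trans (∑-*ˡ F (a * a) L) (cong (a * a *_) (∑-line pr c₀ d₀ (c zero) (d zero) (ind zero) v w)))
        (∑-allFin-const p (- a)))

    -- In the group algebra of F_p², multiplying the elements Σ_u [c_j u] of two independent columns gives the sum of
    -- all of F_p²; so only the terms of the product using at most one column depend on (v, w).
    affineSum-closedForm : ∀ m c d P Q → PairwiseIndependent p c d → ∀ v w →
      a * a * affineSum m c d P Q v w ≡ closedForm m c d P Q v w
    affineSum-closedForm zero c d P Q ind v w = begin
      a * a * (δ p (v ℤ.+ 0ℤ) * δ p (w ℤ.+ 0ℤ) * 1ℚ + 0ℚ)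
        ≡⟨ cong₂ (λ x y → a * a * (δ p x * δ p y * 1ℚ + 0ℚ)) (ℤ.+-identityʳ v) (ℤ.+-identityʳ w) ⟩
      a * a * (δ p v * δ p w * 1ℚ + 0ℚ)
        ≡⟨ solve 2 (λ a x → a :* a :* (x :* con 1ℚ :+ con 0ℚ) :=
             con 1ℚ :+ con 1ℚ :* (a :* a :* x :- con 1ℚ) :+ con 0ℚ) refl a (δ p v * δ p w) ⟩
      1ℚ + 1ℚ * (a * a * (δ p v * δ p w) - 1ℚ) + 0ℚ ∎
      where
      open ≡-Reasoning
    affineSum-closedForm (suc m) c d P Q ind v w = begin
      a * a * affineSum (suc m) c d P Q v w
        ≡⟨ cong (a * a *_) (affineSum-suc m c d P Q v w) ⟩
      a * a * ∑ F (λ u → (p₀ + q₀ * ε u) * W′ u)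
        ≡⟨ ∑-*ˡ F (a * a) _ ⟨
      ∑ F (λ u → a * a * ((p₀ + q₀ * ε u) * W′ u))
        ≡⟨ ∑-cong F (λ u → trans (eq₁ a p₀ q₀ (ε u) (W′ u)) (cong (λ t → p₀ * t + q₀ * (ε u * t)) (IH u))) ⟩
      ∑ F (λ u → p₀ * R (v′ u) (w′ u) + q₀ * (ε u * R (v′ u) (w′ u)))
        ≡⟨ ∑-+ F _ _ ⟩
      ∑ F (λ u → p₀ * R (v′ u) (w′ u)) + ∑ F (λ u → q₀ * (ε u * R (v′ u) (w′ u)))
        ≡⟨ cong₂ _+_ (trans (∑-*ˡ F p₀ _) (cong (p₀ *_) ∑R)) (trans (∑-*ˡ F q₀ _) (cong (q₀ *_) ∑εR)) ⟩
      p₀ * (a * Π + (ΠQ * (a * a * L + a * (- 1ℚ)) + 0ℚ)) + q₀ * R v w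
        ≡⟨ eq₂ a p₀ q₀ Π ΠQ (δ p v * δ p w) L (lineTerm m (c ∘ suc) (d ∘ suc) (P ∘ suc) (Q ∘ suc) v w) ⟩
      closedForm (suc m) c d P Q v w ∎
      where
      open ≡-Reasoning
      F = allFin p
      p₀ = P zero
      q₀ = Q zero
      Π = ∏ m (λ j → a * P (suc j) + Q (suc j))
      ΠQ = ∏ m (Q ∘ suc)
      L = line p (c zero) (d zero) v w
      v′ w′ : Fin p → ℤ
      v′ u = v ℤ.+ c zero ℤ.* ℤ.+ toℕ u
      w′ u = w ℤ.+ d zero ℤ.* ℤ.+ toℕ u
      W′ : Fin p → ℚ
      W′ u = affineSum m (c ∘ suc) (d ∘ suc) (P ∘ suc) (Q ∘ suc) (v′ u) (w′ u)
      R T : ℤ → ℤ → ℚ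
      R = closedForm m (c ∘ suc) (d ∘ suc) (P ∘ suc) (Q ∘ suc)
      T = lineTerm m (c ∘ suc) (d ∘ suc) (P ∘ suc) (Q ∘ suc)
      IH : ∀ u → a * a * W′ u ≡ R (v′ u) (w′ u)
      IH u = affineSum-closedForm m (c ∘ suc) (d ∘ suc) (P ∘ suc) (Q ∘ suc)
        (λ i j i≢j → ind (suc i) (suc j) (i≢j ∘ suc-injective)) (v′ u) (w′ u)
      eq₁ : ∀ a p q e w → a * a * ((p + q * e) * w) ≡ p * (a * a * w) + q * (e * (a * a * w))
      eq₁ = solve 5 (λ a p q e w → a :* a :* ((p :+ q :* e) :* w) := p :* (a :* a :* w) :+ q :* (e :* (a :* a :* w))) refl
      eq₂ : ∀ a p q π κ x l t →
        p * (a * π + (κ * (a * a * l + a * (- 1ℚ)) + 0ℚ)) + q * (π + κ * (a * a * x - 1ℚ) + t) ≡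
        (a * p + q) * π + q * κ * (a * a * x - 1ℚ) + (p * κ * (a * a * l - a) + q * t)
      eq₂ = solve 8 (λ a p q π κ x l t →
        p :* (a :* π :+ (κ :* (a :* a :* l :+ a :* (:- con 1ℚ)) :+ con 0ℚ)) :+ q :* (π :+ κ :* (a :* a :* x :- con 1ℚ) :+ t) :=
        (a :* p :+ q) :* π :+ q :* κ :* (a :* a :* x :- con 1ℚ) :+ (p :* κ :* (a :* a :* l :- a) :+ q :* t)) refl
      -- Letting the first variable run freely turns the correction for no free variable into the
      -- correction for the first column, and kills the corrections for the later columns.
      ∑R : ∑ F (λ u → R (v′ u) (w′ u)) ≡ a * Π + (ΠQ * (a * a * L + a * (- 1ℚ)) + 0ℚ)
      ∑R = begin
        ∑ F (λ u → Π + ΠQ * (a * a * (δ p (v′ u) * δ p (w′ u)) - 1ℚ) + T (v′ u) (w′ u))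
          ≡⟨ ∑-cong F (λ u → +-assoc Π _ (T (v′ u) (w′ u))) ⟩
        ∑ F (λ u → Π + (ΠQ * (a * a * (δ p (v′ u) * δ p (w′ u)) - 1ℚ) + T (v′ u) (w′ u)))
          ≡⟨ trans (∑-+ F (λ _ → Π) _) (cong₂ _+_ (∑-allFin-const p Π) (∑-+ F _ _)) ⟩
        a * Π + (∑ F (λ u → ΠQ * (a * a * (δ p (v′ u) * δ p (w′ u)) - 1ℚ)) + ∑ F (λ u → T (v′ u) (w′ u)))
          ≡⟨ cong₂ (λ x y → a * Π + (x + y))
               (trans (∑-*ˡ F ΠQ _) (cong (ΠQ *_) (trans (∑-+ F _ (λ _ → - 1ℚ))
                 (cong₂ _+_ (∑-*ˡ F (a * a) _) (∑-allFin-const p (- 1ℚ))))))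
               (∑-lineTerm m (c ∘ suc) (d ∘ suc) (P ∘ suc) (Q ∘ suc) (c zero) (d zero) (λ j → ind zero (suc j) (λ ())) v w) ⟩
        a * Π + (ΠQ * (a * a * L + a * (- 1ℚ)) + 0ℚ) ∎
      at-0 : ∀ z c → z ℤ.+ c ℤ.* ℤ.+ toℕ (0F {p}) ≡ z
      at-0 z c = trans (cong (λ n → z ℤ.+ c ℤ.* ℤ.+ n) toℕ-0F) (trans (cong (λ t → z ℤ.+ t) (ℤ.*-zeroʳ c)) (ℤ.+-identityʳ z))
      ∑εR : ∑ F (λ u → ε u * R (v′ u) (w′ u)) ≡ R v w
      ∑εR = begin
        ∑ F (λ u → ε u * R (v′ u) (w′ u))
          ≡⟨ ∑-allFin-single p _ 0F (λ u u≢0 → trans (cong (_* R (v′ u) (w′ u))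
               (ε-≢0 u (λ u≡0 → u≢0 (toℕ-injective (trans u≡0 (sym toℕ-0F)))))) (*-zeroˡ (R (v′ u) (w′ u)))) ⟩
        ε (0F {p}) * R (v′ 0F) (w′ 0F)
          ≡⟨ cong (_* R (v′ 0F) (w′ 0F)) (ε-≡0 0F toℕ-0F) ⟩
        1ℚ * R (v′ 0F) (w′ 0F)
          ≡⟨ *-identityˡ (R (v′ 0F) (w′ 0F)) ⟩
        R (v′ 0F) (w′ 0F)
          ≡⟨ cong₂ R (at-0 v (c zero)) (at-0 w (d zero)) ⟩
        R v w ∎

-- Products with one exceptional factor

+/ : (m : ℕ) → (Fin m → ℚ) → ℚ
+/ zero    f = 0ℚ
+/ (suc m) f = f zero + +/ m (f ∘ suc)

infixr 8 _^_
_^_ : ℚ → ℕ → ℚ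
x ^ zero  = 1ℚ
x ^ suc n = x * x ^ n

at : ∀ {m} → Fin m → ℚ → ℚ → Fin m → ℚ
at zero    x y zero    = x
at zero    x y (suc j) = y
at (suc i) x y zero    = y
at (suc i) x y (suc j) = at i x y j

-- The coefficient of t in the product of the Q_j + t P_j, that is, the sum over i of P_i times the
-- product of the other Q_j.
mixed : (m : ℕ) (P Q : Fin m → ℚ) → ℚ
mixed zero    P Q = 0ℚ
mixed (suc m) P Q = P zero * ∏ m (Q ∘ suc) + Q zero * mixed m (P ∘ suc) (Q ∘ suc)

replaceAt : ∀ {m} → Fin m → (P Q : Fin m → ℚ) → Fin m → ℚ
replaceAt zero    P Q zero    = P zero
replaceAt zero    P Q (suc j) = Q (suc j)
replaceAt (suc i) P Q zero    = Q zero
replaceAt (suc i) P Q (suc j) = replaceAt i (P ∘ suc) (Q ∘ suc) j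

*-cancelˡ : ∀ r {x y} → 0ℚ <ℚ r → r * x ≡ r * y → x ≡ y
*-cancelˡ r {x} {y} 0<r e = ≤-antisym
  (*-cancelˡ-≤-pos r {{positive 0<r}} (≤-reflexive e))
  (*-cancelˡ-≤-pos r {{positive 0<r}} (≤-reflexive (sym e)))

at-≡ : ∀ {m} (i : Fin m) x y → at i x y i ≡ x
at-≡ zero    x y = refl
at-≡ (suc i) x y = at-≡ i x y

at-≢ : ∀ {m} (i j : Fin m) x y → j ≢ i → at i x y j ≡ y
at-≢ zero    zero    x y j≢i = contradiction refl j≢i
at-≢ zero    (suc j) x y j≢i = refl
at-≢ (suc i) zero    x y j≢i = refl
at-≢ (suc i) (suc j) x y j≢i = at-≢ i j x y (j≢i ∘ cong suc)

∏-zero : ∀ m (f : Fin m → ℚ) i → f i ≡ 0ℚ → ∏ m f ≡ 0ℚ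
∏-zero (suc m) f zero    e = trans (cong (_* ∏ m (f ∘ suc)) e) (*-zeroˡ (∏ m (f ∘ suc)))
∏-zero (suc m) f (suc i) e = trans (cong (f zero *_) (∏-zero m (f ∘ suc) i e)) (*-zeroʳ (f zero))

∏-const : ∀ m x → ∏ m (λ _ → x) ≡ x ^ m
∏-const zero    x = refl
∏-const (suc m) x = cong (x *_) (∏-const m x)

∏-one : ∀ m (f : Fin m → ℚ) → (∀ j → f j ≡ 1ℚ) → ∏ m f ≡ 1ℚ
∏-one zero    f e = refl
∏-one (suc m) f e = trans (cong₂ _*_ (e zero) (∏-one m (f ∘ suc) (e ∘ suc))) (*-identityˡ 1ℚ)

∏-single : ∀ m (f : Fin m → ℚ) i → (∀ j → j ≢ i → f j ≡ 1ℚ) → ∏ m f ≡ f i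
∏-single (suc m) f zero    e =
  trans (cong (f zero *_) (∏-one m (f ∘ suc) (λ j → e (suc j) (λ ())))) (*-identityʳ (f zero))
∏-single (suc m) f (suc i) e =
  trans (cong₂ _*_ (e zero (λ ())) (∏-single m (f ∘ suc) i (λ j j≢i → e (suc j) (j≢i ∘ suc-injective))))
    (*-identityˡ (f (suc i)))

∏-at : ∀ m (i : Fin (suc m)) x y → ∏ (suc m) (at i x y) ≡ x * y ^ m
∏-at m       zero    x y = cong (x *_) (∏-const m y)
∏-at (suc m) (suc i) x y = trans (cong (y *_) (∏-at m i x y))
  (solve 3 (λ x y z → y :* (x :* z) := x :* (y :* z)) refl x y (y ^ m))

-- Each term omits only one of the Q_j, so two zeros leave at least one in every term.
mixed-zero : ∀ m (P Q : Fin m → ℚ) i j → i ≢ j → Q i ≡ 0ℚ → Q j ≡ 0ℚ → mixed m P Q ≡ 0ℚ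
mixed-zero (suc m) P Q zero    zero    i≢j e₁ e₂ = contradiction refl i≢j
mixed-zero (suc m) P Q zero    (suc j) i≢j e₁ e₂ = trans
  (cong₂ (λ x y → P zero * x + y * mixed m (P ∘ suc) (Q ∘ suc)) (∏-zero m (Q ∘ suc) j e₂) e₁)
  (solve 2 (λ p x → p :* con 0ℚ :+ con 0ℚ :* x := con 0ℚ) refl (P zero) (mixed m (P ∘ suc) (Q ∘ suc)))
mixed-zero (suc m) P Q (suc i) zero    i≢j e₁ e₂ = mixed-zero (suc m) P Q zero (suc i) (λ ()) e₂ e₁
mixed-zero (suc m) P Q (suc i) (suc j) i≢j e₁ e₂ = trans
  (cong₂ (λ x y → P zero * x + Q zero * y) (∏-zero m (Q ∘ suc) j e₂)
    (mixed-zero m (P ∘ suc) (Q ∘ suc) i j (i≢j ∘ cong suc) e₁ e₂))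
  (solve 2 (λ p q → p :* con 0ℚ :+ q :* con 0ℚ := con 0ℚ) refl (P zero) (Q zero))

mixed-const : ∀ m (P : Fin (suc m) → ℚ) q → mixed (suc m) P (λ _ → q) ≡ q ^ m * +/ (suc m) P
mixed-const zero    P q = solve 2 (λ p q → p :* con 1ℚ :+ q :* con 0ℚ := con 1ℚ :* (p :+ con 0ℚ)) refl (P zero) q
mixed-const (suc m) P q = trans
  (cong₂ (λ x y → P zero * (q * x) + q * y) (∏-const m q) (mixed-const m (P ∘ suc) q))
  (solve 4 (λ p q x s → p :* (q :* x) :+ q :* (x :* s) := q :* x :* (p :+ s)) refl
    (P zero) q (q ^ m) (+/ (suc m) (P ∘ suc)))

mixed-at : ∀ m (i : Fin (suc m)) x q → mixed (suc m) (at i x 0ℚ) (at i 0ℚ q) ≡ x * q ^ m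
mixed-at m       zero    x q = trans
  (cong (λ y → x * y + 0ℚ * mixed m (λ _ → 0ℚ) (λ _ → q)) (∏-const m q))
  (solve 3 (λ x y z → x :* y :+ con 0ℚ :* z := x :* y) refl x (q ^ m) (mixed m (λ _ → 0ℚ) (λ _ → q)))
mixed-at (suc m) (suc i) x q = trans
  (cong (λ y → 0ℚ * ∏ (suc m) (at i 0ℚ q) + q * y) (mixed-at m i x q))
  (solve 4 (λ x y z q → con 0ℚ :* z :+ q :* (x :* y) := x :* (q :* y)) refl x (q ^ m) (∏ (suc m) (at i 0ℚ q)) q)

+/-cong : ∀ m {f g : Fin m → ℚ} → (∀ j → f j ≡ g j) → +/ m f ≡ +/ m g
+/-cong zero    e = refl
+/-cong (suc m) e = cong₂ _+_ (e zero) (+/-cong m (e ∘ suc))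

+/-*ˡ : ∀ m (f : Fin m → ℚ) x → +/ m (λ j → x * f j) ≡ x * +/ m f
+/-*ˡ zero    f x = sym (*-zeroʳ x)
+/-*ˡ (suc m) f x = trans (cong (x * f zero +_) (+/-*ˡ m (f ∘ suc) x)) (sym (*-distribˡ-+ x (f zero) (+/ m (f ∘ suc))))

+/-const : ∀ m x → +/ m (λ _ → x) ≡ ι m * x
+/-const zero    x = sym (*-zeroˡ x)
+/-const (suc m) x = trans (cong (x +_) (+/-const m x))
  (solve 2 (λ x m → x :+ m :* x := (con 1ℚ :+ m) :* x) refl x (ι m))

+/-shift : ∀ m (f : Fin m → ℚ) x → +/ m (λ j → f j + x) ≡ +/ m f + ι m * x
+/-shift zero    f x = solve 1 (λ x → con 0ℚ := con 0ℚ :+ con 0ℚ :* x) refl x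
+/-shift (suc m) f x = trans (cong ((f zero + x) +_) (+/-shift m (f ∘ suc) x))
  (solve 4 (λ f x s m → f :+ x :+ (s :+ m :* x) := f :+ s :+ (con 1ℚ :+ m) :* x) refl (f zero) x (+/ m (f ∘ suc)) (ι m))

mixed-expand : ∀ m (P Q : Fin m → ℚ) → mixed m P Q ≡ +/ m (λ i → ∏ m (replaceAt i P Q))
mixed-expand zero    P Q = refl
mixed-expand (suc m) P Q = cong (P zero * ∏ m (Q ∘ suc) +_) (trans
  (cong (Q zero *_) (mixed-expand m (P ∘ suc) (Q ∘ suc)))
  (sym (+/-*ˡ m (λ i → ∏ m (replaceAt i (P ∘ suc) (Q ∘ suc))) (Q zero))))

∑-+/-swap : ∀ {A : Set} (xs : List A) m (f : A → Fin m → ℚ) →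
  ∑ xs (λ x → +/ m (f x)) ≡ +/ m (λ i → ∑ xs (λ x → f x i))
∑-+/-swap xs zero    f = ∑-zero xs
∑-+/-swap xs (suc m) f = trans (∑-+ xs (λ x → f x zero) (λ x → +/ m (f x ∘ suc)))
  (cong (∑ xs (λ x → f x zero) +_) (∑-+/-swap xs m (λ x → f x ∘ suc)))

replaceAt-affine : ∀ m (i : Fin m) x q (e : Fin m → ℚ) j →
  replaceAt i (λ _ → x) (λ j → q * e j) j ≡ at i x 0ℚ j + at i 0ℚ q j * e j
replaceAt-affine (suc m) zero    x q e zero    = solve 2 (λ x e → x := x :+ con 0ℚ :* e) refl x (e zero)
replaceAt-affine (suc m) zero    x q e (suc j) = sym (+-identityˡ (q * e (suc j)))
replaceAt-affine (suc m) (suc i) x q e zero    = sym (+-identityˡ (q * e zero))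
replaceAt-affine (suc m) (suc i) x q e (suc j) = replaceAt-affine m i x q (e ∘ suc) j

two-others : ∀ {m} (i : Fin (3 ℕ.+ m)) → ∃₂ λ j j′ → j ≢ i × j′ ≢ i × j ≢ j′
two-others zero          = suc zero , suc (suc zero) , (λ ()) , (λ ()) , (λ ())
two-others (suc zero)    = zero , suc (suc zero) , (λ ()) , (λ ()) , (λ ())
two-others (suc (suc i)) = zero , suc zero , (λ ()) , (λ ()) , (λ ())

-- Weighted sums and the moments of `h₀` on one coordinate

module _ {A : Set} (xs : List A) (σ : A → ℚ) where

  weighted-*ˡ : (c : ℚ) (f : A → ℚ) → ∑ xs (λ x → σ x * (c * f x)) ≡ c * ∑ xs (λ x → σ x * f x)
  weighted-*ˡ c f = trans (∑-cong xs (λ x → solve 3 (λ s c f → s :* (c :* f) := c :* (s :* f)) refl (σ x) c (f x)))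
    (∑-*ˡ xs c (λ x → σ x * f x))

  weighted-*ʳ : (f : A → ℚ) (c : ℚ) → ∑ xs (λ x → σ x * (f x * c)) ≡ ∑ xs (λ x → σ x * f x) * c
  weighted-*ʳ f c = trans (∑-cong xs (λ x → sym (*-assoc (σ x) (f x) c))) (∑-*ʳ xs (λ x → σ x * f x) c)

  weighted-+ : (f g : A → ℚ) → ∑ xs (λ x → σ x * (f x + g x)) ≡ ∑ xs (λ x → σ x * f x) + ∑ xs (λ x → σ x * g x)
  weighted-+ f g = trans (∑-cong xs (λ x → *-distribˡ-+ (σ x) (f x) (g x))) (∑-+ xs (λ x → σ x * f x) (λ x → σ x * g x))

  weighted-+/ : ∀ m (f : A → Fin m → ℚ) →
    ∑ xs (λ x → σ x * +/ m (f x)) ≡ +/ m (λ i → ∑ xs (λ x → σ x * f x i))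
  weighted-+/ m f = trans (∑-cong xs (λ x → sym (+/-*ˡ m (f x) (σ x)))) (∑-+/-swap xs m (λ x i → σ x * f x i))

h₀ : ∀ {p} → Fin p → ℚ
h₀ {p} u = ι p * ε u - 1ℚ

module _ {p : ℕ} {k : ℕ} (0<a : 0ℚ <ℚ ι p) (σ : Vec (Fin p) (3 ℕ.+ k) → ℚ)
  (affine : ∀ P Q →
    ι p * ι p * ∑ (allVecs (allFin p) (3 ℕ.+ k)) (λ u → σ u * ∏ (3 ℕ.+ k) (λ j → P j + Q j * ε (lookup u j))) ≡
    ∏ (3 ℕ.+ k) (λ j → ι p * P j + Q j) + ∏ (3 ℕ.+ k) Q * (ι p * ι p - 1ℚ)
      + mixed (3 ℕ.+ k) P Q * (ι p * ι p - ι p)) where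
  open ≡-Reasoning
  private
    K = 3 ℕ.+ k
    m = 2 ℕ.+ k
    a = ι p
    q = a * a
    κ = ι K
    V = allVecs (allFin p) K
    E : (Vec (Fin p) K → ℚ) → ℚ
    E Φ = ∑ V (λ u → σ u * Φ u)
    E-cong : ∀ {Φ Ψ : Vec (Fin p) K → ℚ} → (∀ u → Φ u ≡ Ψ u) → E Φ ≡ E Ψ
    E-cong e = ∑-cong V (λ u → cong (σ u *_) (e u))

  total : ℚ
  total = ∑ V σ

  E-one : E (λ _ → 1ℚ) ≡ total
  E-one = ∑-cong V (λ u → *-identityʳ (σ u))

  q*-cancel : ∀ {x y} → q * x ≡ q * y → x ≡ y
  q*-cancel {x} {y} e = *-cancelˡ a 0<a (*-cancelˡ a 0<a (trans (sym (*-assoc a a x)) (trans e (*-assoc a a y))))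

  -- The case P = 1, Q = 0: a weight that indicates solutions has p^(K - 2) of them. Sums against
  -- the weight stay unnormalised, and identities carry the factor `q` so that no negative power of
  -- p appears.
  total-formula : q * total ≡ a ^ K
  total-formula = begin
    q * total
      ≡⟨ cong (q *_) E-one ⟨
    q * E (λ _ → 1ℚ)
      ≡⟨ cong (q *_) (E-cong (λ u → ∏-one K _ (λ j → solve 1 (λ e → con 1ℚ :+ con 0ℚ :* e := con 1ℚ) refl (ε (lookup u j))))) ⟨
    q * E (λ u → ∏ K (λ j → 1ℚ + 0ℚ * ε (lookup u j)))
      ≡⟨ affine (λ _ → 1ℚ) (λ _ → 0ℚ) ⟩
    ∏ K (λ _ → a * 1ℚ + 0ℚ) + ∏ K (λ _ → 0ℚ) * (q - 1ℚ) + mixed K (λ _ → 1ℚ) (λ _ → 0ℚ) * (q - a)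
      ≡⟨ cong₂ (λ x y → x + y * (q - 1ℚ) + mixed K (λ _ → 1ℚ) (λ _ → 0ℚ) * (q - a)) (∏-const K (a * 1ℚ + 0ℚ)) (∏-zero K (λ _ → 0ℚ) zero refl) ⟩
    (a * 1ℚ + 0ℚ) ^ K + 0ℚ * (q - 1ℚ) + mixed K (λ _ → 1ℚ) (λ _ → 0ℚ) * (q - a)
      ≡⟨ cong₂ (λ x y → x ^ K + 0ℚ * (q - 1ℚ) + y * (q - a)) (solve 1 (λ a → a :* con 1ℚ :+ con 0ℚ := a) refl a)
           (mixed-zero K (λ _ → 1ℚ) (λ _ → 0ℚ) zero (suc zero) (λ ()) refl refl) ⟩
    a ^ K + 0ℚ * (q - 1ℚ) + 0ℚ * (q - a)
      ≡⟨ solve 2 (λ x a → x :+ con 0ℚ :* (a :* a :- con 1ℚ) :+ con 0ℚ :* (a :* a :- a) := x) refl (a ^ K) a ⟩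
    a ^ K ∎

  -- Here Q is supported at i alone. Two other coordinates therefore kill both correction terms, and
  -- the main product vanishes because its factor at i is -a + a.
  E-h₀ : ∀ i → E (λ u → h₀ (lookup u i)) ≡ 0ℚ
  E-h₀ i with two-others i
  ... | j , j′ , j≢i , j′≢i , j≢j′ = q*-cancel (begin
    q * E (λ u → h₀ (lookup u i))
      ≡⟨ cong (q *_) (E-cong (λ u → trans (∏-single K _ i (λ l l≢i → trans
           (cong₂ (λ x y → x + y * ε (lookup u l)) (at-≢ i l (- 1ℚ) 1ℚ l≢i) (at-≢ i l a 0ℚ l≢i))
           (solve 1 (λ e → con 1ℚ :+ con 0ℚ :* e := con 1ℚ) refl (ε (lookup u l)))))
         (trans (cong₂ (λ x y → x + y * ε (lookup u i)) (at-≡ i (- 1ℚ) 1ℚ) (at-≡ i a 0ℚ))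
           (+-comm (- 1ℚ) (a * ε (lookup u i)))))) ⟨
    q * E (λ u → ∏ K (λ l → P l + Q l * ε (lookup u l)))
      ≡⟨ affine P Q ⟩
    ∏ K (λ l → a * P l + Q l) + ∏ K Q * (q - 1ℚ) + mixed K P Q * (q - a)
      ≡⟨ cong₂ _+_ (cong₂ (λ x y → x + y * (q - 1ℚ))
           (∏-zero K (λ l → a * P l + Q l) i (trans (cong₂ (λ x y → a * x + y) (at-≡ i (- 1ℚ) 1ℚ) (at-≡ i a 0ℚ))
             (solve 1 (λ a → a :* (:- con 1ℚ) :+ a := con 0ℚ) refl a)))
           (∏-zero K Q j (at-≢ i j a 0ℚ j≢i)))
         (cong (_* (q - a)) (mixed-zero K P Q j j′ j≢j′ (at-≢ i j a 0ℚ j≢i) (at-≢ i j′ a 0ℚ j′≢i))) ⟩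
    0ℚ + 0ℚ * (q - 1ℚ) + 0ℚ * (q - a)
      ≡⟨ solve 1 (λ a → con 0ℚ :+ con 0ℚ :* (a :* a :- con 1ℚ) :+ con 0ℚ :* (a :* a :- a) := a :* a :* con 0ℚ) refl a ⟩
    q * 0ℚ ∎)
    where
    P Q : Fin K → ℚ
    P = at i (- 1ℚ) 1ℚ
    Q = at i a 0ℚ

  E-+/-shift : ∀ A → E (λ u → +/ K (λ j → A j + h₀ (lookup u j))) ≡ total * +/ K A
  E-+/-shift A = begin
    E (λ u → +/ K (λ j → A j + h₀ (lookup u j)))
      ≡⟨ weighted-+/ V σ K (λ u j → A j + h₀ (lookup u j)) ⟩
    +/ K (λ j → E (λ u → A j + h₀ (lookup u j)))
      ≡⟨ +/-cong K (λ j → begin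
        E (λ u → A j + h₀ (lookup u j))          ≡⟨ weighted-+ V σ (λ _ → A j) (λ u → h₀ (lookup u j)) ⟩
        E (λ _ → A j) + E (λ u → h₀ (lookup u j)) ≡⟨ cong₂ _+_ (∑-*ʳ V σ (A j)) (E-h₀ j) ⟩
        total * A j + 0ℚ                          ≡⟨ +-identityʳ (total * A j) ⟩
        total * A j ∎) ⟩
    +/ K (λ j → total * A j)
      ≡⟨ +/-*ˡ K A total ⟩
    total * +/ K A ∎

  -- The normalised average of the product of the h₀(u_j): the case A = 0 of `E-∏-shift`.
  shiftConstant : ℚ
  shiftConstant = (a - 1ℚ) * (a + 1ℚ - κ)

  -- With P_j = A_j - 1 and Q_j = a, the factor a P_j + Q_j is a A_j because `h₀` has mean zero. The
  -- correction terms supply the rest, and they are of degree at most one in A.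
  E-∏-shift : ∀ A → E (λ u → ∏ K (λ j → A j + h₀ (lookup u j))) ≡ total * (∏ K A + ((a - 1ℚ) * +/ K A + shiftConstant))
  E-∏-shift A = q*-cancel (begin
    q * E (λ u → ∏ K (λ j → A j + h₀ (lookup u j)))
      ≡⟨ cong (q *_) (E-cong (λ u → ∏-cong K (λ j →
           solve 3 (λ x a e → x :+ (a :* e :- con 1ℚ) := x :- con 1ℚ :+ a :* e) refl (A j) a (ε (lookup u j))))) ⟩
    q * E (λ u → ∏ K (λ j → A j - 1ℚ + a * ε (lookup u j)))
      ≡⟨ affine (λ j → A j - 1ℚ) (λ _ → a) ⟩
    ∏ K (λ j → a * (A j - 1ℚ) + a) + ∏ K (λ _ → a) * (q - 1ℚ) + mixed K (λ j → A j - 1ℚ) (λ _ → a) * (q - a)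
      ≡⟨ cong₂ _+_ (cong₂ (λ x y → x + y * (q - 1ℚ))
           (trans (∏-cong K (λ j → solve 2 (λ a x → a :* (x :- con 1ℚ) :+ a := a :* x) refl a (A j)))
             (trans (∏-* K (λ _ → a) A) (cong (_* ∏ K A) (∏-const K a))))
           (∏-const K a))
         (cong (_* (q - a)) (trans (mixed-const m (λ j → A j - 1ℚ) a) (cong (a ^ m *_) (+/-shift K A (- 1ℚ))))) ⟩
    a ^ K * ∏ K A + a ^ K * (q - 1ℚ) + a ^ m * (+/ K A + κ * (- 1ℚ)) * (q - a)
      ≡⟨ solve 5 (λ a x π s κ → a :* x :* π :+ a :* x :* (a :* a :- con 1ℚ) :+ x :* (s :+ κ :* (:- con 1ℚ)) :* (a :* a :- a) :=
           a :* x :* (π :+ ((a :- con 1ℚ) :* s :+ (a :- con 1ℚ) :* (a :+ con 1ℚ :- κ)))) refl a (a ^ m) (∏ K A) (+/ K A) κ ⟩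
    a ^ K * (∏ K A + ((a - 1ℚ) * +/ K A + shiftConstant))
      ≡⟨ cong (_* (∏ K A + ((a - 1ℚ) * +/ K A + shiftConstant))) total-formula ⟨
    q * total * (∏ K A + ((a - 1ℚ) * +/ K A + shiftConstant))
      ≡⟨ *-assoc q total (∏ K A + ((a - 1ℚ) * +/ K A + shiftConstant)) ⟩
    q * (total * (∏ K A + ((a - 1ℚ) * +/ K A + shiftConstant))) ∎)

  bump : ℚ
  bump = E (λ u → E (λ u′ → ∏ K (λ j → q * ε (lookup u j) * ε (lookup u′ j) - 1ℚ)))

  -- For fixed u the integrand is a product of factors affine in ε(u′_j), with coefficients
  -- depending on u, so `affine` evaluates the inner sum. Each of the three resulting terms is again
  -- of a form to which `affine` applies in u.
  bump-formula : q * (q * bump) ≡ q ^ m * q * ((a - 1ℚ) * (a + 1ℚ) * (1ℚ + q - κ))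
  bump-formula = begin
    q * (q * bump)
      ≡⟨ cong (q *_) (weighted-*ˡ V σ q _) ⟨
    q * E (λ u → q * E (λ u′ → ∏ K (λ j → q * ε (lookup u j) * ε (lookup u′ j) - 1ℚ)))
      ≡⟨ cong (q *_) (E-cong (λ u → trans
           (cong (q *_) (E-cong (λ u′ → ∏-cong K (λ j → +-comm (q * ε (lookup u j) * ε (lookup u′ j)) (- 1ℚ)))))
           (affine (λ _ → - 1ℚ) (λ j → q * ε (lookup u j))))) ⟩
    q * E (λ u → X u + Y u * (q - 1ℚ) + Z u * (q - a))
      ≡⟨ cong (q *_) (trans (weighted-+ V σ _ _) (cong₂ _+_
           (trans (weighted-+ V σ X _) (cong (E X +_) (weighted-*ʳ V σ Y (q - 1ℚ)))) (weighted-*ʳ V σ Z (q - a)))) ⟩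
    q * (E X + E Y * (q - 1ℚ) + E Z * (q - a))
      ≡⟨ solve 5 (λ a x y q z → q :* (x :+ y :* (q :- con 1ℚ) :+ z :* (q :- a)) :=
           q :* x :+ q :* y :* (q :- con 1ℚ) :+ q :* z :* (q :- a)) refl a (E X) (E Y) q (E Z) ⟩
    q * E X + q * E Y * (q - 1ℚ) + q * E Z * (q - a)
      ≡⟨ cong₂ _+_ (cong₂ (λ x y → x + y * (q - 1ℚ)) qEX qEY) (cong (_* (q - a)) qEZ) ⟩
    q * q ^ m * (q - 1ℚ) + q ^ m * (κ * (- a)) * (q - a) + q * (q * q ^ m) * (q - 1ℚ) + κ * (- (q * q ^ m)) * (q - a)
      ≡⟨ solve 3 (λ a x κ → (a :* a) :* x :* ((a :* a) :- con 1ℚ) :+ x :* (κ :* (:- a)) :* ((a :* a) :- a)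
             :+ (a :* a) :* ((a :* a) :* x) :* ((a :* a) :- con 1ℚ) :+ κ :* (:- ((a :* a) :* x)) :* ((a :* a) :- a) :=
           x :* (a :* a) :* ((a :- con 1ℚ) :* (a :+ con 1ℚ) :* (con 1ℚ :+ a :* a :- κ))) refl a (q ^ m) κ ⟩
    q ^ m * q * ((a - 1ℚ) * (a + 1ℚ) * (1ℚ + q - κ)) ∎
    where
    X Y Z : Vec (Fin p) K → ℚ
    X u = ∏ K (λ j → a * (- 1ℚ) + q * ε (lookup u j))
    Y u = ∏ K (λ j → q * ε (lookup u j))
    Z u = mixed K (λ _ → - 1ℚ) (λ j → q * ε (lookup u j))
    -- The factors of X have P = -a and Q = a², so a P + Q = 0 and only corrections survive.
    qEX : q * E X ≡ q * q ^ m * (q - 1ℚ) + q ^ m * (κ * (- a)) * (q - a)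
    qEX = begin
      q * E X
        ≡⟨ affine (λ _ → a * (- 1ℚ)) (λ _ → q) ⟩
      ∏ K (λ _ → a * (a * (- 1ℚ)) + q) + ∏ K (λ _ → q) * (q - 1ℚ) + mixed K (λ _ → a * (- 1ℚ)) (λ _ → q) * (q - a)
        ≡⟨ cong₂ _+_ (cong₂ (λ x y → x + y * (q - 1ℚ))
             (∏-zero K (λ _ → a * (a * (- 1ℚ)) + q) zero (solve 1 (λ a → a :* (a :* (:- con 1ℚ)) :+ a :* a := con 0ℚ) refl a)) (∏-const K q))
             (cong (_* (q - a)) (trans (mixed-const m (λ _ → a * (- 1ℚ)) q) (cong (q ^ m *_) (+/-const K (a * (- 1ℚ)))))) ⟩
      0ℚ + q * q ^ m * (q - 1ℚ) + q ^ m * (κ * (a * (- 1ℚ))) * (q - a)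
        ≡⟨ solve 4 (λ a x κ q → con 0ℚ :+ q :* x :* (q :- con 1ℚ) :+ x :* (κ :* (a :* (:- con 1ℚ))) :* (q :- a) :=
             q :* x :* (q :- con 1ℚ) :+ x :* (κ :* (:- a)) :* (q :- a)) refl a (q ^ m) κ q ⟩
      q * q ^ m * (q - 1ℚ) + q ^ m * (κ * (- a)) * (q - a) ∎
    -- Y is nonzero only at u = 0, where it equals q^K.
    qEY : q * E Y ≡ q * (q * q ^ m)
    qEY = begin
      q * E Y
        ≡⟨ cong (q *_) (E-cong (λ u → ∏-cong K (λ j → +-identityˡ (q * ε (lookup u j))))) ⟨
      q * E (λ u → ∏ K (λ j → 0ℚ + q * ε (lookup u j)))
        ≡⟨ affine (λ _ → 0ℚ) (λ _ → q) ⟩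
      ∏ K (λ _ → a * 0ℚ + q) + ∏ K (λ _ → q) * (q - 1ℚ) + mixed K (λ _ → 0ℚ) (λ _ → q) * (q - a)
        ≡⟨ cong₂ _+_ (cong₂ (λ x y → x + y * (q - 1ℚ))
             (trans (∏-const K (a * 0ℚ + q)) (cong (_^ K) (solve 2 (λ a q → a :* con 0ℚ :+ q := q) refl a q))) (∏-const K q))
             (cong (_* (q - a)) (trans (mixed-const m (λ _ → 0ℚ) q) (cong (q ^ m *_) (+/-const K 0ℚ)))) ⟩
      q * q ^ m + q * q ^ m * (q - 1ℚ) + q ^ m * (κ * 0ℚ) * (q - a)
        ≡⟨ solve 4 (λ a x κ q → q :* x :+ q :* x :* (q :- con 1ℚ) :+ x :* (κ :* con 0ℚ) :* (q :- a) :=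
             q :* (q :* x)) refl a (q ^ m) κ q ⟩
      q * (q * q ^ m) ∎
    qEZ : q * E Z ≡ κ * (- (q * q ^ m))
    qEZ = begin
      q * E Z
        ≡⟨ cong (q *_) (trans (E-cong (λ u → mixed-expand K (λ _ → - 1ℚ) (λ j → q * ε (lookup u j))))
             (weighted-+/ V σ K (λ u i → ∏ K (replaceAt i (λ _ → - 1ℚ) (λ j → q * ε (lookup u j)))))) ⟩
      q * +/ K (λ i → E (λ u → ∏ K (replaceAt i (λ _ → - 1ℚ) (λ j → q * ε (lookup u j)))))
        ≡⟨ +/-*ˡ K (λ i → E (λ u → ∏ K (replaceAt i (λ _ → - 1ℚ) (λ j → q * ε (lookup u j))))) q ⟨
      +/ K (λ i → q * E (λ u → ∏ K (replaceAt i (λ _ → - 1ℚ) (λ j → q * ε (lookup u j)))))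
        ≡⟨ +/-cong K one-replaced ⟩
      +/ K (λ _ → - (q * q ^ m))
        ≡⟨ +/-const K (- (q * q ^ m)) ⟩
      κ * (- (q * q ^ m)) ∎
      where
      -- For the weight of a system with nonzero columns, a solution that vanishes outside i
      -- vanishes at i too, so each term is -q^m from u = 0 alone. Here `affine` yields this by
      -- cancelling the two terms that contain a · q^m.
      one-replaced : ∀ i → q * E (λ u → ∏ K (replaceAt i (λ _ → - 1ℚ) (λ j → q * ε (lookup u j)))) ≡ - (q * q ^ m)
      one-replaced i with two-others i
      ... | j , j′ , j≢i , j′≢i , j≢j′ = begin
        q * E (λ u → ∏ K (replaceAt i (λ _ → - 1ℚ) (λ j → q * ε (lookup u j))))
          ≡⟨ cong (q *_) (E-cong (λ u → ∏-cong K (replaceAt-affine K i (- 1ℚ) q (λ j → ε (lookup u j))))) ⟩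
        q * E (λ u → ∏ K (λ j → at i (- 1ℚ) 0ℚ j + at i 0ℚ q j * ε (lookup u j)))
          ≡⟨ affine (at i (- 1ℚ) 0ℚ) (at i 0ℚ q) ⟩
        ∏ K (λ j → a * at i (- 1ℚ) 0ℚ j + at i 0ℚ q j) + ∏ K (at i 0ℚ q) * (q - 1ℚ)
          + mixed K (at i (- 1ℚ) 0ℚ) (at i 0ℚ q) * (q - a)
          ≡⟨ cong₂ _+_ (cong₂ (λ x y → x + y * (q - 1ℚ))
               (trans (∏-cong K (scaled i)) (∏-at m i (- a) q)) (∏-zero K (at i 0ℚ q) i (at-≡ i 0ℚ q)))
               (cong (_* (q - a)) (mixed-at m i (- 1ℚ) q)) ⟩
        - a * q ^ m + 0ℚ * (q - 1ℚ) + - 1ℚ * q ^ m * (q - a)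
          ≡⟨ solve 3 (λ a x q → (:- a) :* x :+ con 0ℚ :* (q :- con 1ℚ) :+ (:- con 1ℚ) :* x :* (q :- a) := :- (q :* x)) refl a (q ^ m) q ⟩
        - (q * q ^ m) ∎
        where
        scaled : ∀ {n} (i j : Fin n) → a * at i (- 1ℚ) 0ℚ j + at i 0ℚ q j ≡ at i (- a) q j
        scaled zero    zero    = solve 1 (λ a → a :* (:- con 1ℚ) :+ con 0ℚ := :- a) refl a
        scaled zero    (suc j) = solve 2 (λ a q → a :* con 0ℚ :+ q := q) refl a q
        scaled (suc i) zero    = solve 2 (λ a q → a :* con 0ℚ :+ q := q) refl a q
        scaled (suc i) (suc j) = scaled i j

-- Solutions over F_p^n

allᵇ : {A : Set} → List A → (A → Bool) → Bool
allᵇ []       P = true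
allᵇ (x ∷ xs) P = P x ∧ allᵇ xs P

fold-unique : {A : Set} (f : List A → (A → Bool) → Bool) → (∀ P → f [] P ≡ true) →
  (∀ x xs P → f (x ∷ xs) P ≡ (P x ∧ f xs P)) → ∀ xs P → f xs P ≡ allᵇ xs P
fold-unique f f[] f∷ []       P = f[] P
fold-unique f f[] f∷ (x ∷ xs) P = trans (f∷ x xs P) (cong (P x ∧_) (fold-unique f f[] f∷ xs P))

allᵇ-tabulate : {A B : Set} (n : ℕ) (f : Fin n → A) (g : Fin n → B) (P : A → Bool) (Q : B → Bool) →
  (∀ i → P (f i) ≡ Q (g i)) → allᵇ (tabulate f) P ≡ allᵇ (tabulate g) Q
allᵇ-tabulate zero    f g P Q e = refl
allᵇ-tabulate (suc n) f g P Q e = cong₂ _∧_ (e zero) (allᵇ-tabulate n (f ∘ suc) (g ∘ suc) P Q (e ∘ suc))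

sumF-cong : ∀ {p} .{{_ : NonZero p}} k {f g : Fin k → Fin p} → (∀ j → f j ≡ g j) → sumF k f ≡ sumF k g
sumF-cong zero    e = refl
sumF-cong (suc k) e = cong₂ _+F_ (e zero) (sumF-cong k (e ∘ suc))

module _ {p k : ℕ} .{{_ : NonZero p}} (M : System p k) where

  column : Fin 2 → Fin k → ℤ
  column r j = ℤ.+ toℕ (M r j)

  -- The summand `0ℤ` makes this, by definition, the weight in `affineSum` at the base point (0, 0).
  σ : Vec (Fin p) k → ℚ
  σ u = δ p (0ℤ ℤ.+ dot k (column row₀) u) * δ p (0ℤ ℤ.+ dot k (column row₁) u)

  vanishes : ∀ {n} → Fin 2 → Vec (Vec (Fin p) n) k → Fin n → Bool
  vanishes r x t = isZeroF (sumF k (λ j → M r j *F lookup (lookup x j) t))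

  isSol-all : ∀ {n} (x : Vec (Vec (Fin p) n) k) →
    isSol M x ≡ (allᵇ (allFin n) (vanishes row₀ x) ∧ (allᵇ (allFin n) (vanishes row₁ x) ∧ true))
  isSol-all {n} x = main
    where
    -- Unification in main solves f to the local function of isSol, which has no name in scope here; the
    -- with-abstraction turns its arguments, and _∧_, into variables so that the constraint is a pattern.
    f : List (Fin n) → (Fin n → Bool) → Bool
    f = _
    main : isSol M x ≡ (allᵇ (allFin n) (vanishes row₀ x) ∧ (allᵇ (allFin n) (vanishes row₁ x) ∧ true))
    main with allFin n | vanishes row₀ x | vanishes row₁ x | _∧_
    ... | ts | P | Q | and = cong₂ (λ b c → and b (and c true))
      (fold-unique f (λ _ → refl) (λ _ _ _ → refl) ts P)
      (fold-unique f (λ _ → refl) (λ _ _ _ → refl) ts Q)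

  𝟙-vanishes-zero : ∀ {n} r u (y : Vec (Vec (Fin p) n) k) →
    𝟙 (vanishes r (zipWith _∷_ u y) zero) ≡ δ p (0ℤ ℤ.+ dot k (column r) u)
  𝟙-vanishes-zero r u y = trans
    (cong ε (sumF-cong k (λ j → cong (λ v → M r j *F lookup v zero) (lookup-zipWith _∷_ j u y))))
    (trans (ε-sumF k (M r) u) (cong (δ p) (sym (ℤ.+-identityˡ (dot k (column r) u)))))

  vanishes-suc : ∀ {n} r u (y : Vec (Vec (Fin p) n) k) t → vanishes r (zipWith _∷_ u y) (suc t) ≡ vanishes r y t
  vanishes-suc r u y t =
    cong isZeroF (sumF-cong k (λ j → cong (λ v → M r j *F lookup v (suc t)) (lookup-zipWith _∷_ j u y)))

  -- The equations act on every coordinate of F_p^n separately, so the indicator of solutions is a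
  -- product over coordinates.
  𝟙-isSol-∷ : ∀ {n} u (y : Vec (Vec (Fin p) n) k) → 𝟙 (isSol M (zipWith _∷_ u y)) ≡ σ u * 𝟙 (isSol M y)
  𝟙-isSol-∷ {n} u y = begin
    𝟙 (isSol M z)
      ≡⟨ cong 𝟙 (isSol-all z) ⟩
    𝟙 ((vanishes row₀ z zero ∧ allᵇ (tabulate suc) (vanishes row₀ z)) ∧ ((vanishes row₁ z zero ∧ allᵇ (tabulate suc) (vanishes row₁ z)) ∧ true))
      ≡⟨ cong₂ (λ x y → 𝟙 ((vanishes row₀ z zero ∧ x) ∧ ((vanishes row₁ z zero ∧ y) ∧ true)))
           (allᵇ-tabulate n suc id (vanishes row₀ z) (vanishes row₀ y) (vanishes-suc row₀ u y))
           (allᵇ-tabulate n suc id (vanishes row₁ z) (vanishes row₁ y) (vanishes-suc row₁ u y)) ⟩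
    𝟙 ((vanishes row₀ z zero ∧ A₀) ∧ ((vanishes row₁ z zero ∧ A₁) ∧ true))
      ≡⟨ regroup (vanishes row₀ z zero) A₀ (vanishes row₁ z zero) A₁ ⟩
    (𝟙 (vanishes row₀ z zero) * 𝟙 (vanishes row₁ z zero)) * 𝟙 (A₀ ∧ (A₁ ∧ true))
      ≡⟨ cong₂ _*_ (cong₂ _*_ (𝟙-vanishes-zero row₀ u y) (𝟙-vanishes-zero row₁ u y)) (cong 𝟙 (sym (isSol-all y))) ⟩
    σ u * 𝟙 (isSol M y) ∎
    where
    open ≡-Reasoning
    z = zipWith _∷_ u y
    A₀ = allᵇ (allFin n) (vanishes row₀ y)
    A₁ = allᵇ (allFin n) (vanishes row₁ y)
    regroup : ∀ b B c C → 𝟙 ((b ∧ B) ∧ ((c ∧ C) ∧ true)) ≡ (𝟙 b * 𝟙 c) * 𝟙 (B ∧ (C ∧ true))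
    regroup false B c     C = sym (trans (cong (_* 𝟙 (B ∧ (C ∧ true))) (*-zeroˡ (𝟙 c))) (*-zeroˡ (𝟙 (B ∧ (C ∧ true)))))
    regroup true  B true  C = sym (*-identityˡ (𝟙 (B ∧ (C ∧ true))))
    regroup true  true  false C = sym (*-zeroˡ (𝟙 (C ∧ true)))
    regroup true  false false C = refl

  solSum : ∀ n → (Vec (Vec (Fin p) n) k → ℚ) → ℚ
  solSum n Φ = ∑ (allVecs (allFpn p n) k) (λ x → 𝟙 (isSol M x) * Φ x)

  solSum-suc : ∀ n Φ → solSum (suc n) Φ ≡ ∑ (allVecs (allFin p) k) (λ u → σ u * solSum n (λ y → Φ (zipWith _∷_ u y)))
  solSum-suc n Φ = trans (∑-allVecs-zipWith-∷ (allFin p) n k (λ x → 𝟙 (isSol M x) * Φ x))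
    (∑-cong (allVecs (allFin p) k) (λ u → trans
      (∑-cong (allVecs (allFpn p n) k) (λ y → trans
        (cong (_* Φ (zipWith _∷_ u y)) (𝟙-isSol-∷ u y)) (*-assoc (σ u) (𝟙 (isSol M y)) (Φ (zipWith _∷_ u y)))))
      (∑-*ˡ (allVecs (allFpn p n) k) (σ u) (λ y → 𝟙 (isSol M y) * Φ (zipWith _∷_ u y)))))

  solSum-zero : ∀ Φ c → (∀ x → Φ x ≡ c) → solSum 0 Φ ≡ c
  solSum-zero Φ c e = trans (∑-cong (allVecs (allFpn p 0) k) (λ x → trans
      (cong₂ (λ b y → 𝟙 b * y) (isSol-all x) (e x)) (*-identityˡ c))) (singleton k)
    where
    singleton : ∀ k → ∑ (allVecs (allFpn p 0) k) (λ _ → c) ≡ c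
    singleton zero    = +-identityʳ c
    singleton (suc k) = trans (∑-allVecs-suc (allFpn p 0) k (λ _ → c)) (trans (+-identityʳ _) (singleton k))

  -- At (v, w) = (0, 0) the base point lies on the line of every column, so all dependence on the
  -- columns disappears. With 1 < k each column has a partner showing that it is nonzero.
  affine-average : Prime p → 1 ℕ.< k → PairwiseIndependent p (column row₀) (column row₁) → ∀ P Q →
    ι p * ι p * ∑ (allVecs (allFin p) k) (λ u → σ u * ∏ k (λ j → P j + Q j * ε (lookup u j))) ≡
    ∏ k (λ j → ι p * P j + Q j) + ∏ k Q * (ι p * ι p - 1ℚ) + mixed k P Q * (ι p * ι p - ι p)
  affine-average pr 1<k ind P Q = begin
    a * a * affineSum k (column row₀) (column row₁) P Q 0ℤ 0ℤ
      ≡⟨ affineSum-closedForm pr k (column row₀) (column row₁) P Q ind 0ℤ 0ℤ ⟩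
    ∏ k (λ j → a * P j + Q j) + ∏ k Q * (a * a * (δ p 0ℤ * δ p 0ℤ) - 1ℚ) + lineTerm k (column row₀) (column row₁) P Q 0ℤ 0ℤ
      ≡⟨ cong₂ _+_
           (cong (λ x → ∏ k (λ j → a * P j + Q j) + ∏ k Q * (x - 1ℚ)) (trans (cong (a * a *_)
             (trans (cong₂ _*_ p∣0 p∣0) (*-identityˡ 1ℚ))) (*-identityʳ (a * a))))
           (lineTerm-0 k (column row₀) (column row₁) P Q (λ j → through-0 j (other k 1<k j))) ⟩
    ∏ k (λ j → a * P j + Q j) + ∏ k Q * (a * a - 1ℚ) + mixed k P Q * (a * a - a) ∎
    where
    open ≡-Reasoning
    a = ι p
    p∣0 : δ p 0ℤ ≡ 1ℚ
    p∣0 = δ-∣ {p} {0ℤ} (divides 0ℤ refl)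
    other : ∀ k → 1 ℕ.< k → (j : Fin k) → ∃ λ i → j ≢ i
    other (suc (suc k)) _ zero    = suc zero , λ ()
    other (suc (suc k)) _ (suc j) = zero , λ ()
    other (suc zero) (s≤s ()) _
    through-0 : ∀ j → (∃ λ i → j ≢ i) → line p (column row₀ j) (column row₁ j) 0ℤ 0ℤ ≡ 1ℚ
    through-0 j (i , j≢i) =
      line-0 pr (column row₀ j) (column row₁ j) (column row₀ i) (column row₁ i) (ind j i j≢i)
    lineTerm-0 : ∀ m (c d : Fin m → ℤ) P Q → (∀ j → line p (c j) (d j) 0ℤ 0ℤ ≡ 1ℚ) →
      lineTerm m c d P Q 0ℤ 0ℤ ≡ mixed m P Q * (a * a - a)
    lineTerm-0 zero    c d P Q e = sym (*-zeroˡ (a * a - a))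
    lineTerm-0 (suc m) c d P Q e = trans
      (cong₂ (λ x y → P zero * ∏ m (Q ∘ suc) * (a * a * x - a) + Q zero * y) (e zero)
        (lineTerm-0 m (c ∘ suc) (d ∘ suc) (P ∘ suc) (Q ∘ suc) (e ∘ suc)))
      (solve 5 (λ a p π q x → p :* π :* (a :* a :* con 1ℚ :- a) :+ q :* (x :* (a :* a :- a)) :=
          (p :* π :+ q :* x) :* (a :* a :- a)) refl a (P zero) (∏ m (Q ∘ suc)) (Q zero) (mixed m (P ∘ suc) (Q ∘ suc)))

  columns-bound : PairwiseIndependent p (column row₀) (column row₁) → k ℕ.≤ p ℕ.* p
  columns-bound ind = injective⇒≤ {f = λ j → combine (M row₀ j) (M row₁ j)} injective
    where
    eq : ∀ c d → det c d c d ≡ 0ℤ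
    eq c d = ℤ.i≡j⇒i-j≡0 (ℤ.*-comm c d)
    injective : ∀ {i j} → combine (M row₀ i) (M row₁ i) ≡ combine (M row₀ j) (M row₁ j) → i ≡ j
    injective {i} {j} e with i ≟ᶠ j | combine-injective (M row₀ i) (M row₁ i) (M row₀ j) (M row₁ j) e
    ... | yes i≡j | _ = i≡j
    ... | no  i≢j | e₀ , e₁ = contradiction (divides 0ℤ (trans
      (cong₂ (λ x y → det (column row₀ i) (column row₁ i) (ℤ.+ toℕ x) (ℤ.+ toℕ y)) (sym e₀) (sym e₁))
      (eq (column row₀ i) (column row₁ i)))) (ind i j i≢j)

-- From the minimum length k - 1 to pairwise independent columns

count-≤ : {A : Set} (n : ℕ) (f : Fin n → A) (P : A → Bool) → length (filterᵇ P (tabulate f)) ℕ.≤ n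
count-≤ zero    f P = z≤n
count-≤ (suc n) f P with P (f zero)
... | true  = s≤s (count-≤ n (f ∘ suc) P)
... | false = ℕ.m≤n⇒m≤1+n (count-≤ n (f ∘ suc) P)

count-one : {A : Set} (n : ℕ) (f : Fin n → A) (P : A → Bool) (i : Fin n) → P (f i) ≡ false →
  suc (length (filterᵇ P (tabulate f))) ℕ.≤ n
count-one (suc n) f P zero e rewrite e = s≤s (count-≤ n (f ∘ suc) P)
count-one (suc n) f P (suc i) e with P (f zero)
... | true  = s≤s (count-one n (f ∘ suc) P i e)
... | false = ℕ.m≤n⇒m≤1+n (count-one n (f ∘ suc) P i e)

count-two : {A : Set} (n : ℕ) (f : Fin n → A) (P : A → Bool) (i j : Fin n) → i ≢ j →
  P (f i) ≡ false → P (f j) ≡ false → 2 ℕ.+ length (filterᵇ P (tabulate f)) ℕ.≤ n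
count-two (suc n) f P zero    zero    i≢j e₁ e₂ = contradiction refl i≢j
count-two (suc n) f P zero    (suc j) i≢j e₁ e₂ rewrite e₁ = s≤s (count-one n (f ∘ suc) P j e₂)
count-two (suc n) f P (suc i) zero    i≢j e₁ e₂ rewrite e₂ = s≤s (count-one n (f ∘ suc) P i e₁)
count-two (suc n) f P (suc i) (suc j) i≢j e₁ e₂ with P (f zero)
... | true  = s≤s (count-two n (f ∘ suc) P i j (i≢j ∘ cong suc) e₁ e₂)
... | false = ℕ.m≤n⇒m≤1+n (count-two n (f ∘ suc) P i j (i≢j ∘ cong suc) e₁ e₂)

module _ {p k : ℕ} .{{_ : NonZero p}} (M : System p k) (rank : FullRank M)
  (short : ∀ a b → NonzeroVec (rowComb M a b) → k ℕ.∸ 1 ℕ.≤ eqLength (rowComb M a b)) where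

  -- Two vanishing coefficients bound the length by k - 2, so the combination cannot be a nonzero
  -- equation; full rank then forces both multipliers to vanish.
  no-two-zeros : ∀ a b i j → i ≢ j → toℕ (rowComb M a b i) ≡ 0 → toℕ (rowComb M a b j) ≡ 0 →
    (toℕ a ≡ 0) × (toℕ b ≡ 0)
  no-two-zeros a b i j i≢j e₁ e₂ with any? (λ l → ¬? (toℕ (rowComb M a b l) ℕ.≟ 0))
  ... | no  none = rank a b (λ l → decidable-stable (toℕ (rowComb M a b l) ℕ.≟ 0) (λ n → none (l , n)))
  ... | yes some = contradiction (ℕ.≤-trans (s≤s (s≤s (short a b some)))
        (count-two k id (λ l → not (isZeroF (rowComb M a b l))) i j i≢j (nz i e₁) (nz j e₂))) (too-large k)
    where
    nz : ∀ l → toℕ (rowComb M a b l) ≡ 0 → not (isZeroF (rowComb M a b l)) ≡ false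
    nz l e rewrite e = refl
    too-large : ∀ k → ¬ (2 ℕ.+ (k ℕ.∸ 1) ℕ.≤ k)
    too-large (suc k) (s≤s h) = ℕ.<-irrefl refl h

  independent-kernel : ∀ i j → i ≢ j → ∀ α β →
    ℤ.+ p ∣ α ℤ.* column M row₀ i ℤ.+ β ℤ.* column M row₁ i →
    ℤ.+ p ∣ α ℤ.* column M row₀ j ℤ.+ β ℤ.* column M row₁ j →
    (ℤ.+ p ∣ α) × (ℤ.+ p ∣ β)
  independent-kernel i j i≢j α β hi hj = from-residue α (proj₁ ab≡0) , from-residue β (proj₂ ab≡0)
    where
    eq : ∀ α β a b c d r → r ≡ ℤ.-1ℤ ℤ.* (a ℤ.* c ℤ.+ b ℤ.* d ℤ.- r) ℤ.+
      1ℤ ℤ.* (1ℤ ℤ.* (α ℤ.* c ℤ.+ β ℤ.* d) ℤ.+ (ℤ.- c) ℤ.* (α ℤ.- a) ℤ.+ (ℤ.- d) ℤ.* (β ℤ.- b))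
    eq = solve-∀
    kills : ∀ l → ℤ.+ p ∣ α ℤ.* column M row₀ l ℤ.+ β ℤ.* column M row₁ l →
      toℕ (rowComb M (residue α) (residue β) l) ≡ 0
    kills l h = ∣toℕ⇒≡0 r (∣-lin₂ (ℤ.+ toℕ r) ℤ.-1ℤ 1ℤ (∣-rowComb M (residue α) (residue β) l)
      (∣-lin₃ _ 1ℤ (ℤ.- column M row₀ l) (ℤ.- column M row₁ l) h (∣-residue α) (∣-residue β) refl)
      (eq α β (ℤ.+ toℕ (residue {p} α)) (ℤ.+ toℕ (residue {p} β)) (column M row₀ l) (column M row₁ l) (ℤ.+ toℕ r)))
      where r = rowComb M (residue α) (residue β) l
    ab≡0 : (toℕ (residue {p} α) ≡ 0) × (toℕ (residue {p} β) ≡ 0)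
    ab≡0 = no-two-zeros (residue α) (residue β) i j i≢j (kills i hi) (kills j hj)
    eq₀ : ∀ z → z ≡ 1ℤ ℤ.* (z ℤ.- 0ℤ)
    eq₀ = solve-∀
    from-residue : ∀ z → toℕ (residue {p} z) ≡ 0 → ℤ.+ p ∣ z
    from-residue z e = ∣-lin₁ z 1ℤ (subst (λ n → ℤ.+ p ∣ z ℤ.- ℤ.+ n) e (∣-residue z)) (eq₀ z)

  -- If the determinant vanishes, the multipliers (d_i, -c_i) annihilate both columns, so column i
  -- is zero by `independent-kernel`; column j is zero likewise. Then (1, 0) also annihilates both
  -- columns, and p would divide 1.
  pairwise-independent : 1 ℕ.< p → PairwiseIndependent p (column M row₀) (column M row₁)
  pairwise-independent 1<p i j i≢j p∣Δ = ℕ.<⇒≱ 1<p (ℕ.∣⇒≤ (∣⇒∣ᵤ (proj₁ p∣1)))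
    where
    c = column M row₀
    d = column M row₁
    eq₁ : ∀ c d → d ℤ.* c ℤ.+ (ℤ.- c) ℤ.* d ≡ 0ℤ
    eq₁ = solve-∀
    eq₂ : ∀ c d c′ d′ → d ℤ.* c′ ℤ.+ (ℤ.- c) ℤ.* d′ ≡ ℤ.-1ℤ ℤ.* (c ℤ.* d′ ℤ.- d ℤ.* c′)
    eq₂ = solve-∀
    eq₃ : ∀ c d c′ d′ → d′ ℤ.* c ℤ.+ (ℤ.- c′) ℤ.* d ≡ 1ℤ ℤ.* (c ℤ.* d′ ℤ.- d ℤ.* c′)
    eq₃ = solve-∀
    eq₄ : ∀ c → c ≡ ℤ.-1ℤ ℤ.* (ℤ.- c)
    eq₄ = solve-∀
    eq₅ : ∀ c d → 1ℤ ℤ.* c ℤ.+ 0ℤ ℤ.* d ≡ 1ℤ ℤ.* c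
    eq₅ = solve-∀
    at-i : (ℤ.+ p ∣ d i) × (ℤ.+ p ∣ ℤ.- c i)
    at-i = independent-kernel i j i≢j (d i) (ℤ.- c i)
      (divides 0ℤ (eq₁ (c i) (d i))) (∣-lin₁ _ ℤ.-1ℤ p∣Δ (eq₂ (c i) (d i) (c j) (d j)))
    at-j : (ℤ.+ p ∣ d j) × (ℤ.+ p ∣ ℤ.- c j)
    at-j = independent-kernel i j i≢j (d j) (ℤ.- c j)
      (∣-lin₁ _ 1ℤ p∣Δ (eq₃ (c i) (d i) (c j) (d j))) (divides 0ℤ (eq₁ (c j) (d j)))
    p∣1 : (ℤ.+ p ∣ 1ℤ) × (ℤ.+ p ∣ 0ℤ)
    p∣1 = independent-kernel i j i≢j 1ℤ 0ℤ
      (∣-lin₁ _ 1ℤ (∣-lin₁ (c i) ℤ.-1ℤ (proj₂ at-i) (eq₄ (c i))) (eq₅ (c i) (d i)))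
      (∣-lin₁ _ 1ℤ (∣-lin₁ (c j) ℤ.-1ℤ (proj₂ at-j) (eq₄ (c j))) (eq₅ (c j) (d j)))

-- Signs

ι-+ : ∀ m n → ι (m ℕ.+ n) ≡ ι m + ι n
ι-+ zero    n = sym (+-identityˡ (ι n))
ι-+ (suc m) n = trans (cong (1ℚ +_) (ι-+ m n)) (sym (+-assoc 1ℚ (ι m) (ι n)))

ι-* : ∀ m n → ι (m ℕ.* n) ≡ ι m * ι n
ι-* zero    n = sym (*-zeroˡ (ι n))
ι-* (suc m) n = trans (ι-+ n (m ℕ.* n)) (trans (cong (ι n +_) (ι-* m n))
  (solve 2 (λ m n → n :+ m :* n := (con 1ℚ :+ m) :* n) refl (ι m) (ι n)))

ι-^ : ∀ m n → ι (m ℕ.^ n) ≡ ι m ^ n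
ι-^ m zero    = +-identityʳ 1ℚ
ι-^ m (suc n) = trans (ι-* m (m ℕ.^ n)) (cong (ι m *_) (ι-^ m n))

0≤1 : 0ℚ ≤ℚ 1ℚ
0≤1 = nonNegative⁻¹ 1ℚ

0<1 : 0ℚ <ℚ 1ℚ
0<1 = positive⁻¹ 1ℚ

ι-nonNeg : ∀ n → 0ℚ ≤ℚ ι n
ι-nonNeg zero    = ≤-refl
ι-nonNeg (suc n) = +-mono-≤ 0≤1 (ι-nonNeg n)

ι-mono : ∀ {m n} → m ℕ.≤ n → ι m ≤ℚ ι n
ι-mono {n = n} z≤n = ι-nonNeg n
ι-mono (s≤s m≤n)   = +-monoʳ-≤ 1ℚ (ι-mono m≤n)

ι-pos : ∀ {n} → 0 ℕ.< n → 0ℚ <ℚ ι n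
ι-pos {suc n} _ = +-mono-<-≤ 0<1 (ι-nonNeg n)

*-pos : ∀ {x y} → 0ℚ <ℚ x → 0ℚ <ℚ y → 0ℚ <ℚ x * y
*-pos {x} {y} 0<x 0<y = positive⁻¹ (x * y) {{pos*pos⇒pos x {{positive 0<x}} y {{positive 0<y}}}}

^-pos : ∀ {x} n → 0ℚ <ℚ x → 0ℚ <ℚ x ^ n
^-pos zero    0<x = 0<1
^-pos (suc n) 0<x = *-pos 0<x (^-pos n 0<x)

*-pos-neg : ∀ {x y} → 0ℚ <ℚ x → y <ℚ 0ℚ → x * y <ℚ 0ℚ
*-pos-neg {x} {y} 0<x y<0 = subst (x * y <ℚ_) (*-zeroʳ x) (*-monoʳ-<-pos x {{positive 0<x}} y<0)

*-cancelˡ-pos : ∀ {x y} → 0ℚ <ℚ x → 0ℚ <ℚ x * y → 0ℚ <ℚ y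
*-cancelˡ-pos {x} {y} 0<x 0<xy =
  *-cancelˡ-<-nonNeg x {{nonNegative (<⇒≤ 0<x)}} (subst (_<ℚ x * y) (sym (*-zeroʳ x)) 0<xy)

neg-^ : ∀ x n → (- x) ^ n ≡ x ^ n ⊎ (- x) ^ n ≡ - (x ^ n)
neg-^ x zero    = inj₁ refl
neg-^ x (suc n) with neg-^ x n
... | inj₁ e = inj₂ (trans (cong (- x *_) e) (sym (neg-distribˡ-* x (x ^ n))))
... | inj₂ e = inj₁ (trans (cong (- x *_) e) (solve 2 (λ x y → (:- x) :* (:- y) := x :* y) refl x (x ^ n)))

-- This bound holds for either parity of the exponent, so the sign of (-a)^k is never decided.
neg-^-≤ : ∀ {x} n → 0ℚ <ℚ x → (- x) ^ n ≤ℚ x ^ n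
neg-^-≤ {x} n 0<x with neg-^ x n
... | inj₁ e = ≤-reflexive e
... | inj₂ e = ≤-trans (≤-reflexive e) (≤-trans (neg-antimono-≤ (<⇒≤ (^-pos n 0<x))) (<⇒≤ (^-pos n 0<x)))

bounded-Fin : ∀ n (B : Fin n → ℚ) → (∀ i → 0ℚ <ℚ B i) → ∃ λ C → 0ℚ <ℚ C × (∀ i → B i ≤ℚ C)
bounded-Fin zero    B 0<B = 1ℚ , 0<1 , λ ()
bounded-Fin (suc n) B 0<B with bounded-Fin n (B ∘ suc) (0<B ∘ suc)
... | C , 0<C , B≤C = B zero + C , +-mono-< (0<B zero) 0<C , bound
  where
  bound : ∀ i → B i ≤ℚ B zero + C
  bound zero    = subst (_≤ℚ B zero + C) (+-identityʳ (B zero)) (+-monoʳ-≤ (B zero) (<⇒≤ 0<C))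
  bound (suc i) = subst (_≤ℚ B zero + C) (+-identityˡ (B (suc i))) (+-mono-≤ (<⇒≤ (0<B zero)) (B≤C i))

-- Any bound on a finite domain will do: dividing by it brings the values into [-1, 1] without
-- changing signs.
bounded : ∀ p n (f : Vec (Fin p) n → ℚ) → ∃ λ C → 0ℚ <ℚ C × (∀ x → ℚ.∣ f x ∣ ≤ℚ C)
bounded p zero    f = 1ℚ + ℚ.∣ f [] ∣ , +-mono-<-≤ 0<1 (0≤∣p∣ (f [])) , λ { [] →
  subst (_≤ℚ 1ℚ + ℚ.∣ f [] ∣) (+-identityˡ ℚ.∣ f [] ∣) (+-monoˡ-≤ ℚ.∣ f [] ∣ 0≤1) }
bounded p (suc n) f with bounded-Fin p (λ u → proj₁ (IH u)) (λ u → proj₁ (proj₂ (IH u)))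
  where
  IH : ∀ u → ∃ λ C → 0ℚ <ℚ C × (∀ x → ℚ.∣ f (u ∷ x) ∣ ≤ℚ C)
  IH u = bounded p n (λ x → f (u ∷ x))
... | C , 0<C , B≤C = C , 0<C , λ { (u ∷ x) → ≤-trans (proj₂ (proj₂ (bounded p n (λ x → f (u ∷ x)))) x) (B≤C u) }

∣∣≤1⇒∈[-1,1] : ∀ x → ℚ.∣ x ∣ ≤ℚ 1ℚ → (- 1ℚ ≤ℚ x) × (x ≤ℚ 1ℚ)
∣∣≤1⇒∈[-1,1] x ∣x∣≤1 with ∣p∣≡p∨∣p∣≡-p x
... | inj₁ e = ≤-trans (neg-antimono-≤ 0≤1) (∣p∣≡p⇒0≤p e) , subst (_≤ℚ 1ℚ) e ∣x∣≤1
... | inj₂ e = -1≤x , ≤-trans x≤0 0≤1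
  where
  neg-neg : - (- x) ≡ x
  neg-neg = solve 1 (λ x → :- (:- x) := x) refl x
  -1≤x : - 1ℚ ≤ℚ x
  -1≤x = subst (- 1ℚ ≤ℚ_) neg-neg (neg-antimono-≤ (subst (_≤ℚ 1ℚ) e ∣x∣≤1))
  x≤0 : x ≤ℚ 0ℚ
  x≤0 = subst (_≤ℚ 0ℚ) neg-neg (neg-antimono-≤ (subst (0ℚ ≤ℚ_) e (0≤∣p∣ x)))

prodVecℚ-∏ : ∀ {A : Set} k (f : A → ℚ) (x : Vec A k) → prodVecℚ (Vec.map f x) ≡ ∏ k (λ j → f (lookup x j))
prodVecℚ-∏ zero    f []       = refl
prodVecℚ-∏ (suc k) f (a ∷ as) = cong (f a *_) (prodVecℚ-∏ k f as)

-- The unscaled function and its mean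

module _ {p : ℕ} where

  h : ∀ {n} → Vec (Fin p) n → ℚ
  h []      = 0ℚ
  h (u ∷ x) = h₀ u + h x

  witness : ∀ {n} → Vec (Fin p) (2 ℕ.+ n) → ℚ
  witness (u ∷ u′ ∷ x) = (ι p * ι p * ε u * ε u′ - 1ℚ) * (- ι p + h x)

module _ {p : ℕ} .{{_ : NonZero p}} where
  private
    a = ι p
    q = a * a
    F = allFin p

  ∑-ε : ∑ F ε ≡ 1ℚ
  ∑-ε = trans (∑-allFin-single p ε 0F (λ u u≢0 → ε-≢0 u (λ u≡0 → u≢0 (toℕ-injective (trans u≡0 (sym toℕ-0F))))))
    (ε-≡0 0F toℕ-0F)

  -- The factor on the first two coordinates already sums to a² - a · a = 0, whatever the sum H over
  -- the others is.
  ∑-witness : ∀ n → ∑ (allFpn p (2 ℕ.+ n)) witness ≡ 0ℚ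
  ∑-witness n = begin
    ∑ (allFpn p (2 ℕ.+ n)) witness
      ≡⟨ trans (∑-allVecs-suc F (suc n) witness) (∑-cong F (λ u → ∑-allVecs-suc F n (λ x → witness (u ∷ x)))) ⟩
    ∑ F (λ u → ∑ F (λ u′ → ∑ (allFpn p n) (λ x → (q * ε u * ε u′ - 1ℚ) * (- a + h x))))
      ≡⟨ ∑-cong F (λ u → ∑-cong F (λ u′ → ∑-*ˡ (allFpn p n) (q * ε u * ε u′ - 1ℚ) (λ x → - a + h x))) ⟩
    ∑ F (λ u → ∑ F (λ u′ → (q * ε u * ε u′ - 1ℚ) * H))
      ≡⟨ ∑-cong F (λ u → trans (∑-*ʳ F (λ u′ → q * ε u * ε u′ - 1ℚ) H) (cong (_* H) (inner u))) ⟩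
    ∑ F (λ u → (q * ε u + a * (- 1ℚ)) * H)
      ≡⟨ ∑-*ʳ F (λ u → q * ε u + a * (- 1ℚ)) H ⟩
    ∑ F (λ u → q * ε u + a * (- 1ℚ)) * H
      ≡⟨ cong (_* H) (trans (∑-+ F (λ u → q * ε u) (λ _ → a * (- 1ℚ)))
           (cong₂ _+_ (trans (∑-*ˡ F q ε) (cong (q *_) ∑-ε)) (∑-allFin-const p (a * (- 1ℚ))))) ⟩
    (q * 1ℚ + a * (a * (- 1ℚ))) * H
      ≡⟨ solve 2 (λ a h → (a :* a :* con 1ℚ :+ a :* (a :* (:- con 1ℚ))) :* h := con 0ℚ) refl a H ⟩
    0ℚ ∎
    where
    open ≡-Reasoning
    H = ∑ (allFpn p n) (λ x → - a + h x)
    inner : ∀ u → ∑ F (λ u′ → q * ε u * ε u′ - 1ℚ) ≡ q * ε u + a * (- 1ℚ)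
    inner u = trans (∑-+ F (λ u′ → q * ε u * ε u′) (λ _ → - 1ℚ)) (cong₂ _+_
      (trans (∑-*ˡ F (q * ε u) ε) (trans (cong (q * ε u *_) ∑-ε) (*-identityʳ (q * ε u))))
      (∑-allFin-const p (- 1ℚ)))

-- Sums over the solutions in F_p^n

module _ {p k : ℕ} .{{_ : NonZero p}} (M : System p (3 ℕ.+ k)) (pr : Prime p) (0<a : 0ℚ <ℚ ι p)
  (ind : PairwiseIndependent p (column M row₀) (column M row₁)) where
  private
    K = 3 ℕ.+ k
    a = ι p
    q = a * a
    κ = ι K
    V = allVecs (allFin p) K
    affine = affine-average M pr (s≤s (s≤s z≤n)) ind
    τ = total {p} {k} 0<a (σ M) affine
    c = shiftConstant {p} {k} 0<a (σ M) affine
    β = bump {p} {k} 0<a (σ M) affine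

  -- The induction needs arbitrary A, since splitting off a coordinate replaces A_j by A_j +
  -- h₀(u_j). The product then yields one new copy of the linear bracket, while the n copies already
  -- present keep their average because `h₀` has mean zero.
  solSum-∏-shift : ∀ n A → solSum M n (λ x → ∏ K (λ j → A j + h (lookup x j))) ≡
    τ ^ n * (∏ K A + ι n * ((a - 1ℚ) * +/ K A + c))
  solSum-∏-shift zero    A = trans (solSum-zero M _ (∏ K A) (λ x → ∏-cong K (λ j → h-[] (lookup x j) (A j))))
    (solve 2 (λ x y → x := con 1ℚ :* (x :+ con 0ℚ :* y)) refl (∏ K A) ((a - 1ℚ) * +/ K A + c))
    where
    h-[] : ∀ (v : Vec (Fin p) 0) y → y + h v ≡ y
    h-[] [] y = +-identityʳ y
  solSum-∏-shift (suc n) A = begin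
    solSum M (suc n) (λ x → ∏ K (λ j → A j + h (lookup x j)))
      ≡⟨ solSum-suc M n (λ x → ∏ K (λ j → A j + h (lookup x j))) ⟩
    ∑ V (λ u → σ M u * solSum M n (λ y → ∏ K (λ j → A j + h (lookup (zipWith _∷_ u y) j))))
      ≡⟨ ∑-cong V (λ u → cong (σ M u *_) (trans
           (∑-cong (allVecs (allFpn p n) K) (λ y → cong (𝟙 (isSol M y) *_) (∏-cong K (λ j → trans
             (cong (λ v → A j + h v) (lookup-zipWith _∷_ j u y))
             (sym (+-assoc (A j) (h₀ (lookup u j)) (h (lookup y j))))))))
           (solSum-∏-shift n (λ j → A j + h₀ (lookup u j))))) ⟩
    ∑ V (λ u → σ M u * (τ ^ n * (X u + ι n * ((a - 1ℚ) * Y u + c))))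
      ≡⟨ weighted-*ˡ V (σ M) (τ ^ n) (λ u → X u + ι n * ((a - 1ℚ) * Y u + c)) ⟩
    τ ^ n * ∑ V (λ u → σ M u * (X u + ι n * ((a - 1ℚ) * Y u + c)))
      ≡⟨ cong (τ ^ n *_) (trans (weighted-+ V (σ M) X (λ u → ι n * ((a - 1ℚ) * Y u + c)))
           (cong₂ _+_ (E-∏-shift {p} {k} 0<a (σ M) affine A) (trans
             (weighted-*ˡ V (σ M) (ι n) (λ u → (a - 1ℚ) * Y u + c)) (cong (ι n *_) (trans
               (weighted-+ V (σ M) (λ u → (a - 1ℚ) * Y u) (λ _ → c))
               (cong₂ _+_ (trans (weighted-*ˡ V (σ M) (a - 1ℚ) Y)
                 (cong ((a - 1ℚ) *_) (E-+/-shift {p} {k} 0<a (σ M) affine A))) (∑-*ʳ V (σ M) c))))))) ⟩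
    τ ^ n * (τ * (∏ K A + ((a - 1ℚ) * +/ K A + c)) + ι n * ((a - 1ℚ) * (τ * +/ K A) + τ * c))
      ≡⟨ solve 7 (λ T t a π s c n → T :* (t :* (π :+ ((a :- con 1ℚ) :* s :+ c)) :+ n :* ((a :- con 1ℚ) :* (t :* s) :+ t :* c)) :=
           t :* T :* (π :+ (con 1ℚ :+ n) :* ((a :- con 1ℚ) :* s :+ c))) refl (τ ^ n) τ a (∏ K A) (+/ K A) c (ι n) ⟩
    τ ^ suc n * (∏ K A + ι (suc n) * ((a - 1ℚ) * +/ K A + c)) ∎
    where
    open ≡-Reasoning
    X Y : Vec (Fin p) K → ℚ
    X u = ∏ K (λ j → A j + h₀ (lookup u j))
    Y u = +/ K (λ j → A j + h₀ (lookup u j))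

  solSum-witness : ∀ n → solSum M (2 ℕ.+ n) (λ x → ∏ K (λ j → witness (lookup x j))) ≡
    β * solSum M n (λ x → ∏ K (λ j → - a + h (lookup x j)))
  solSum-witness n = begin
    solSum M (2 ℕ.+ n) (λ x → ∏ K (λ j → witness (lookup x j)))
      ≡⟨ solSum-suc M (suc n) (λ x → ∏ K (λ j → witness (lookup x j))) ⟩
    ∑ V (λ u → σ M u * solSum M (suc n) (λ y → ∏ K (λ j → witness (lookup (zipWith _∷_ u y) j))))
      ≡⟨ ∑-cong V (λ u → cong (σ M u *_) (solSum-suc M n (λ y → ∏ K (λ j → witness (lookup (zipWith _∷_ u y) j))))) ⟩
    ∑ V (λ u → σ M u * ∑ V (λ u′ → σ M u′ * solSum M n (λ y → ∏ K (λ j → witness (lookup (zipWith _∷_ u (zipWith _∷_ u′ y)) j)))))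
      ≡⟨ ∑-cong V (λ u → cong (σ M u *_) (∑-cong V (λ u′ → cong (σ M u′ *_) (trans
           (∑-cong (allVecs (allFpn p n) K) (λ y → cong (𝟙 (isSol M y) *_) (trans
             (∏-cong K (λ j → cong witness (trans (lookup-zipWith _∷_ j u (zipWith _∷_ u′ y))
               (cong (lookup u j ∷_) (lookup-zipWith _∷_ j u′ y)))))
             (∏-* K (λ j → q * ε (lookup u j) * ε (lookup u′ j) - 1ℚ) (λ j → - a + h (lookup y j))))))
           (trans (weighted-*ˡ (allVecs (allFpn p n) K) (λ y → 𝟙 (isSol M y)) (B u u′) Ψ) refl))))) ⟩
    ∑ V (λ u → σ M u * ∑ V (λ u′ → σ M u′ * (B u u′ * solSum M n Ψ)))
      ≡⟨ ∑-cong V (λ u → cong (σ M u *_) (weighted-*ʳ V (σ M) (B u) (solSum M n Ψ))) ⟩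
    ∑ V (λ u → σ M u * (∑ V (λ u′ → σ M u′ * B u u′) * solSum M n Ψ))
      ≡⟨ weighted-*ʳ V (σ M) (λ u → ∑ V (λ u′ → σ M u′ * B u u′)) (solSum M n Ψ) ⟩
    β * solSum M n Ψ ∎
    where
    open ≡-Reasoning
    Ψ : Vec (Vec (Fin p) n) K → ℚ
    Ψ y = ∏ K (λ j → - a + h (lookup y j))
    B : Vec (Fin p) K → Vec (Fin p) K → ℚ
    B u u′ = ∏ K (λ j → q * ε (lookup u j) * ε (lookup u′ j) - 1ℚ)

  module _ (k≤p² : K ℕ.≤ p ℕ.* p) (b : ℚ) (0≤b : 0ℚ ≤ℚ b) (a≡3+b : a ≡ 1ℚ + (1ℚ + (1ℚ + b))) where

    0<q : 0ℚ <ℚ q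
    0<q = *-pos 0<a 0<a

    0<1+ : ∀ {x} → 0ℚ ≤ℚ x → 0ℚ <ℚ 1ℚ + x
    0<1+ = +-mono-<-≤ 0<1

    0<1+b : 0ℚ <ℚ 1ℚ + b
    0<1+b = 0<1+ 0≤b

    total-positive : 0ℚ <ℚ τ
    total-positive = *-cancelˡ-pos 0<q
      (subst (0ℚ <ℚ_) (sym (total-formula {p} {k} 0<a (σ M) affine)) (^-pos K 0<a))

    bump-positive : 0ℚ <ℚ β
    bump-positive = *-cancelˡ-pos 0<q (*-cancelˡ-pos 0<q
      (subst (0ℚ <ℚ_) (sym (bump-formula {p} {k} 0<a (σ M) affine))
        (*-pos (*-pos (^-pos (2 ℕ.+ k) 0<q) 0<q) (*-pos (*-pos 0<a-1 0<a+1) 0<1+q-κ))))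
      where
      0<a-1 : 0ℚ <ℚ a - 1ℚ
      0<a-1 = subst (0ℚ <ℚ_) (trans (solve 1 (λ b → con 1ℚ :+ (con 1ℚ :+ b) := con 1ℚ :+ (con 1ℚ :+ (con 1ℚ :+ b)) :- con 1ℚ) refl b)
        (cong (_- 1ℚ) (sym a≡3+b))) (0<1+ (<⇒≤ 0<1+b))
      0<a+1 : 0ℚ <ℚ a + 1ℚ
      0<a+1 = +-mono-< 0<a 0<1
      0<1+q-κ : 0ℚ <ℚ 1ℚ + q - κ
      0<1+q-κ = subst (0ℚ <ℚ_) (sym (+-assoc 1ℚ q (- κ))) (0<1+ (subst (_≤ℚ q - κ) (+-inverseʳ κ)
        (+-monoˡ-≤ (- κ) (subst (κ ≤ℚ_) (ι-* p p) (ι-mono k≤p²)))))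

    -- The left side is 1 - (a² - 1)(κ - 1). With s = a - 2, t = a and w = κ - 2 its negative is
    -- written as a sum of products that are visibly positive for a, κ ≥ 3.
    bracket : ∀ a b y → a ≡ 1ℚ + (1ℚ + (1ℚ + b)) →
      let κ = 1ℚ + (1ℚ + (1ℚ + y)); s = 1ℚ + b; t = 1ℚ + (1ℚ + (1ℚ + b)); w = 1ℚ + y in
      1ℚ + ((a - 1ℚ) * (κ * (- a)) + (a - 1ℚ) * (a + 1ℚ - κ)) ≡ - (s + (1ℚ + s) * t + (1ℚ + s) * (1ℚ + t) * w)
    bracket a b y refl = solve 2 (λ b y →
      let a = con 1ℚ :+ (con 1ℚ :+ (con 1ℚ :+ b)); κ = con 1ℚ :+ (con 1ℚ :+ (con 1ℚ :+ y))
          s = con 1ℚ :+ b; t = con 1ℚ :+ (con 1ℚ :+ (con 1ℚ :+ b)); w = con 1ℚ :+ y in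
      con 1ℚ :+ ((a :- con 1ℚ) :* (κ :* (:- a)) :+ (a :- con 1ℚ) :* (a :+ con 1ℚ :- κ)) :=
      :- (s :+ (con 1ℚ :+ s) :* t :+ (con 1ℚ :+ s) :* (con 1ℚ :+ t) :* w)) refl b y

    -- In dimension p^K the linear term carries the coefficient a^K, which also bounds (-a)^K; it
    -- factors out and leaves `bracket`.
    solSum-shift-negative : solSum M (p ℕ.^ K) (λ x → ∏ K (λ j → - a + h (lookup x j))) <ℚ 0ℚ
    solSum-shift-negative = begin-strict
      solSum M (p ℕ.^ K) (λ x → ∏ K (λ j → - a + h (lookup x j)))
        ≡⟨ solSum-∏-shift (p ℕ.^ K) (λ _ → - a) ⟩
      τ ^ (p ℕ.^ K) * (∏ K (λ _ → - a) + ι (p ℕ.^ K) * ((a - 1ℚ) * +/ K (λ _ → - a) + c))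
        <⟨ *-pos-neg (^-pos (p ℕ.^ K) total-positive) bracket-negative ⟩
      0ℚ ∎
      where
      open ≤-Reasoning
      s = 1ℚ + b
      t = 1ℚ + (1ℚ + (1ℚ + b))
      w = 1ℚ + ι k
      0<t : 0ℚ <ℚ t
      0<t = 0<1+ (<⇒≤ (0<1+ (<⇒≤ 0<1+b)))
      0<Z : 0ℚ <ℚ s + (1ℚ + s) * t + (1ℚ + s) * (1ℚ + t) * w
      0<Z = +-mono-< (+-mono-< 0<1+b (*-pos (0<1+ (<⇒≤ 0<1+b)) 0<t))
        (*-pos (*-pos (0<1+ (<⇒≤ 0<1+b)) (0<1+ (<⇒≤ 0<t))) (0<1+ (ι-nonNeg k)))
      bracket-negative : ∏ K (λ _ → - a) + ι (p ℕ.^ K) * ((a - 1ℚ) * +/ K (λ _ → - a) + c) <ℚ 0ℚ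
      bracket-negative = begin-strict
        ∏ K (λ _ → - a) + ι (p ℕ.^ K) * ((a - 1ℚ) * +/ K (λ _ → - a) + c)
          ≡⟨ cong₂ _+_ (∏-const K (- a)) (cong₂ (λ x y → x * ((a - 1ℚ) * y + c)) (ι-^ p K) (+/-const K (- a))) ⟩
        (- a) ^ K + a ^ K * ((a - 1ℚ) * (κ * (- a)) + c)
          ≤⟨ +-monoˡ-≤ (a ^ K * ((a - 1ℚ) * (κ * (- a)) + c)) (neg-^-≤ K 0<a) ⟩
        a ^ K + a ^ K * ((a - 1ℚ) * (κ * (- a)) + c)
          ≡⟨ solve 2 (λ x y → x :+ x :* y := x :* (con 1ℚ :+ y)) refl (a ^ K) ((a - 1ℚ) * (κ * (- a)) + c) ⟩
        a ^ K * (1ℚ + ((a - 1ℚ) * (κ * (- a)) + c))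
          ≡⟨ cong (a ^ K *_) (bracket a b (ι k) a≡3+b) ⟩
        a ^ K * - (s + (1ℚ + s) * t + (1ℚ + s) * (1ℚ + t) * w)
          <⟨ *-pos-neg (^-pos K 0<a) (neg-antimono-< 0<Z) ⟩
        0ℚ ∎

    solSum-witness-negative : solSum M (2 ℕ.+ p ℕ.^ K) (λ x → ∏ K (λ j → witness (lookup x j))) <ℚ 0ℚ
    solSum-witness-negative = subst (_<ℚ 0ℚ) (sym (solSum-witness (p ℕ.^ K))) (*-pos-neg bump-positive solSum-shift-negative)

-- Rescaling and conclusion

TΨ-negative : ∀ {p k n} .{{_ : NonZero p}} (M : System p k) (f : Vec (Fin p) n → ℚ) r → 0ℚ <ℚ r →
  solSum M n (λ x → ∏ k (λ j → f (lookup x j))) <ℚ 0ℚ → TΨ M (λ x → r * f x) <ℚ 0ℚ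
TΨ-negative {p} {k} {n} M f r 0<r s<0 = mean-negative (map g (sol M n)) (subst (_<ℚ 0ℚ) (sym scaled)
  (*-pos-neg (^-pos k 0<r) s<0))
  where
  open ≡-Reasoning
  g : Vec (Vec (Fin p) n) k → ℚ
  g x = prodVecℚ (Vec.map (λ v → r * f v) x)
  scaled : ∑ (sol M n) g ≡ r ^ k * solSum M n (λ x → ∏ k (λ j → f (lookup x j)))
  scaled = begin
    ∑ (sol M n) g
      ≡⟨ ∑-filter (isSol M) (allVecs (allFpn p n) k) g ⟩
    ∑ (allVecs (allFpn p n) k) (λ x → 𝟙 (isSol M x) * g x)
      ≡⟨ ∑-cong (allVecs (allFpn p n) k) (λ x → cong (𝟙 (isSol M x) *_) (trans (prodVecℚ-∏ k (λ v → r * f v) x)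
           (trans (∏-* k (λ _ → r) (λ j → f (lookup x j))) (cong (_* ∏ k (λ j → f (lookup x j))) (∏-const k r))))) ⟩
    ∑ (allVecs (allFpn p n) k) (λ x → 𝟙 (isSol M x) * (r ^ k * ∏ k (λ j → f (lookup x j))))
      ≡⟨ weighted-*ˡ (allVecs (allFpn p n) k) (λ x → 𝟙 (isSol M x)) (r ^ k) (λ x → ∏ k (λ j → f (lookup x j))) ⟩
    r ^ k * solSum M n (λ x → ∏ k (λ j → f (lookup x j))) ∎

rescale : ∀ {A : Set} (f : A → ℚ) C → 0ℚ <ℚ C → (∀ x → ℚ.∣ f x ∣ ≤ℚ C) →
  ∃ λ r → 0ℚ <ℚ r × (∀ x → (- 1ℚ ≤ℚ r * f x) × (r * f x ≤ℚ 1ℚ))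
rescale f C 0<C ∣f∣≤C = r , 0<r , λ x → ∣∣≤1⇒∈[-1,1] (r * f x) (begin
  ℚ.∣ r * f x ∣     ≡⟨ ∣p*q∣≡∣p∣*∣q∣ r (f x) ⟩
  ℚ.∣ r ∣ * ℚ.∣ f x ∣ ≡⟨ cong (_* ℚ.∣ f x ∣) (0≤p⇒∣p∣≡p (<⇒≤ 0<r)) ⟩
  r * ℚ.∣ f x ∣     ≤⟨ *-monoˡ-≤-nonNeg r {{nonNegative (<⇒≤ 0<r)}} (∣f∣≤C x) ⟩
  r * C           ≡⟨ *-inverseˡ C ⟩
  1ℚ ∎)
  where
  open ≤-Reasoning
  instance
    C-positive : Positive C
    C-positive = positive 0<C
    C-nonZero : ℚ.NonZero C
    C-nonZero = pos⇒nonZero C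
  r = 1/ C
  0<r : 0ℚ <ℚ r
  0<r = positive⁻¹ r {{1/pos⇒pos C}}

theorem3p3 : (p : ℕ) .{{_ : NonZero p}} → Prime p → 2 < p →
  (k : ℕ) → 3 ≤ k →
  (M : System p k) → FullRank M → sIs M (k ∸ 1) →
  Σ ℕ λ n → (0 < n) × Σ (Vec (Fin p) n → ℚ) λ f →
    ((x : Vec (Fin p) n) → (- 1ℚ ≤ℚ f x) × (f x ≤ℚ 1ℚ)) ×
    (expect f ≡ 0ℚ) × (TΨ M f <ℚ 0ℚ)
theorem3p3 p pr 2<p (suc (suc (suc k))) (s≤s (s≤s (s≤s z≤n))) M rank (short , _) =
  n , s≤s z≤n , (λ x → r * witness x) , proj₂ (proj₂ scale) ,
  mean-zero (map (λ x → r * witness x) (allFpn p n)) (trans (∑-*ˡ (allFpn p n) r witness) (trans (cong (r *_) (∑-witness N)) (*-zeroʳ r))) ,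
  TΨ-negative {n = n} M witness r (proj₁ (proj₂ scale))
    (solSum-witness-negative M pr (ι-pos (ℕ.≤-trans (s≤s z≤n) 2<p)) ind (columns-bound M ind) (ι (p ℕ.∸ 3)) (ι-nonNeg (p ℕ.∸ 3))
      -- The hypothesis `2<p` is by definition 3 ≤ p, so p = 3 + (p - 3) and b = p - 3 is
      -- nonnegative.
      (cong ι (sym (ℕ.m+[n∸m]≡n 2<p))))
  where
  N = p ℕ.^ (3 ℕ.+ k)
  n = 2 ℕ.+ N
  bound = bounded p n witness
  scale = rescale witness (proj₁ bound) (proj₁ (proj₂ bound)) (proj₂ (proj₂ bound))
  r = proj₁ scale
  ind = pairwise-independent M rank short (ℕ.<⇒≤ 2<p)
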